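{- Let $m=m(n)$ and $k=k(n)$ be positive integer sequences with $n\ll m\ll n^2/\log^2 n$, and let $(j_n)$ be any sequence of positive integers with $j_n\leq n-k$. For each $n$, let $\boldsymbol{\sigma}_{n,m}$ be a permutation chosen uniformly at random from the set of permutations of $[n]$ with exactly $m$ inversions. Then \[\lim_{n\to\infty}\mathbb{P}\big(\boldsymbol{\sigma}_{n,m}(j_n)>\boldsymbol{\sigma}_{n,m}(j_n+k)\big)=\begin{cases}\tfrac12 & \text{if } k\ll m/n,\\ 0 & \text{if } k\gg m/n.\end{cases}\]
   Context: A permutation of length $n$ is a linear ordering $\sigma(1)\ldots\sigma(n)$ of $[n]$; an inversion is a pair $i<j$ with $\sigma(i)>\sigma(j)$. For sequences, $f\ll g$ (equivalently $g\gg f$) means $f/g\to0$ as $n\to\infty$. -}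

module Defs where

open import Data.Nat as ℕ using (ℕ; zero; suc; _+_; _*_; _^_; _≤_; _<_)
open import Data.Nat.Logarithm using (⌊log₂_⌋)
open import Data.Fin as Fin using (Fin; toℕ; fromℕ<)
import Data.Fin.Properties as FinP
open import Data.Vec as Vec using (Vec; []; _∷_; lookup; toList)
open import Data.List as List using (List; [_]; map; concatMap; allFin; filter; length)
open import Data.Nat.ListAction using (sum)
open import Data.List.Relation.Unary.AllPairs using (AllPairs; allPairs?)
open import Data.Integer using (+_)
open import Data.Rational as ℚ using (ℚ; 0ℚ; ∣_∣; _-_)
open import Data.Product using (Σ; _×_; ∃-syntax)
open import Relation.Nullary using (¬_; ¬?; yes; no)
open import Relation.Nullary.Decidable using (_×-dec_)
open import Relation.Binary.PropositionalEquality using (_≡_; _≢_)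

words : (n k : ℕ) → List (Vec (Fin n) k)
words n zero    = [ [] ]
words n (suc k) = concatMap (λ i → map (i ∷_) (words n k)) (allFin n)

IsPerm : ∀ {n} → Vec (Fin n) n → Set
IsPerm v = AllPairs _≢_ (toList v)

-- The list of all permutations of [n] (entries 0..n-1 encode 1..n).
perms : (n : ℕ) → List (Vec (Fin n) n)
perms n = filter (λ v → allPairs? (λ x y → ¬? (x Fin.≟ y)) (toList v)) (words n n)

inv : ∀ {n} → Vec (Fin n) n → ℕ
inv {n} σ = sum (map (λ i → length (filter (λ j → (i Fin.<? j) ×-dec
                                              (lookup σ j Fin.<? lookup σ i)) (allFin n)))
                     (allFin n))

permsInv : (n m : ℕ) → List (Vec (Fin n) n)
permsInv n m = filter (λ σ → inv σ ℕ.≟ m) (perms n)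

-- Value σ(p) (as a natural number 0..n-1) at the 1-indexed position p; 0 if out of range.
at : ∀ {n} → Vec (Fin n) n → ℕ → ℕ
at {n} σ zero    = 0
at {n} σ (suc p) with p ℕ.<? n
... | yes p<n = toℕ (lookup σ (fromℕ< p<n))
... | no  _   = 0

-- Total rational division of naturals (0 when the denominator is 0).
_÷ℕ_ : ℕ → ℕ → ℚ
a ÷ℕ zero    = 0ℚ
a ÷ℕ suc b   = (+ a) ℚ./ suc b

-- P(σ_{n,m}(j) > σ_{n,m}(j+k)) for σ_{n,m} uniform among permutations of [n]
-- with exactly m inversions (0 if there are none such).
prob : (n m j k : ℕ) → ℚ
prob n m j k =
  length (filter (λ σ → at σ (j + k) ℕ.<? at σ j) (permsInv n m)) ÷ℕ length (permsInv n m)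

_≪_ : (ℕ → ℚ) → (ℕ → ℚ) → Set
f ≪ g = ∀ (ε : ℚ) → 0ℚ ℚ.< ε → ∃[ N ] (∀ n → N ≤ n → ∣ f n ∣ ℚ.≤ ε ℚ.* ∣ g n ∣)

Tendsto : (ℕ → ℚ) → ℚ → Set
Tendsto a L = ∀ (ε : ℚ) → 0ℚ ℚ.< ε → ∃[ N ] (∀ n → N ≤ n → ∣ a n - L ∣ ℚ.≤ ε)

ι : ℕ → ℚ
ι a = a ÷ℕ 1

{-# OPTIONS --safe #-}

-- A permutation σ of [n] corresponds to its Lehmer code c, where c(i) ≤ n - i counts the
-- j > i with σ(j) < σ(i), and the number of inversions is the sum of the code.  So σ is
-- a uniformly random code with sum m.
--
-- Tails.  Moving h units from entry i into one of the other entries (most of them hold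
-- fewer than h, as the total is m) shows that c(i) ≥ h has probability O(m / (n h)).
-- Since σ(i) ≤ c(i) + i - 1, a displacement σ(i) - i ≥ k/4 is unlikely if k ≫ m/n; applied
-- to σ and to its reverse-complement this gives the limit 0.
--
-- The limit ½.  One has c(j) ≥ c(j+k) + k ⇒ σ(j) > σ(j+k) ⇒ c(j) > c(j+k).  Exchanging the
-- two entries is possible unless c(j) is of order n, so up to a tail the events
-- c(j) > c(j+k) and c(j) < c(j+k) are equally likely, and only |c(j) - c(j+k)| < k remains.
-- If V(s) counts the codes of sum s on the other entries, removing a marked unit gives
-- s V(s) ≤ (s - 1 + n) V(s - 1), so V varies by at most a factor 2 over a range of
-- order m/n.  Hence for given c(j) no value of c(j+k) has conditional probability above
-- O(n/m), and the middle event has probability O(k n / m).  Reverse-complement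
-- is used to arrange that both entries have range of order n.
module Submission where

open import Defs
open import Algebra.Properties.CommutativeSemigroup using (interchange; x∙yz≈y∙xz)
import Algebra.Properties.Group as GroupP
open import Data.Nat
open import Data.Nat.DivMod using (_/_; _%_; m≡m%n+[m/n]*n; m%n<n)
open import Data.Nat.ListAction using (sum)
open import Data.Nat.ListAction.Properties using (sum-++; sum-↭)
open import Data.Nat.Logarithm using (⌊log₂_⌋; ⌊log₂⌋-mono-≤; ⌊log₂[2^n]⌋≡n)
open import Data.Nat.Properties
open import Data.Nat.Tactic.RingSolver using (solve-∀)
import Data.Integer as ℤ
import Data.Integer.Properties as ℤP
open import Data.Rational as ℚ using (mkℚ; 0ℚ; ½; ∣_∣)
import Data.Rational.Properties as ℚP
open import Data.Rational.Unnormalised as ℚᵘ using (ℚᵘ; mkℚᵘ; *≤*; *<*)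
import Data.Rational.Unnormalised.Properties as ℚᵘP
open import Data.Fin as Fin using (Fin; zero; suc; toℕ; fromℕ<; punchIn; punchOut)
import Data.Fin.Properties as FinP
open import Data.Vec as Vec using (Vec; []; _∷_; lookup; toList)
import Data.Vec.Properties as VecP
open import Data.List using (List; []; _∷_; _++_; length; map; filter; allFin; tabulate; concatMap; cartesianProduct; cartesianProductWith)
import Data.List.Properties as ListP
open import Data.List.Membership.Propositional using (_∈_)
open import Data.List.Membership.Propositional.Properties using (∈-map⁺; ∈-map⁻; ∈-filter⁺; ∈-filter⁻; ∈-allFin; ∈-cartesianProduct⁺; ∈-cartesianProductWith⁺)
open import Data.List.Membership.Propositional.Properties.WithK using (unique∧set⇒bag)
open import Data.List.Relation.Binary.BagAndSetEquality using (∼bag⇒↭)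
open import Data.List.Relation.Binary.Permutation.Propositional using (_↭_)
import Data.List.Relation.Binary.Permutation.Propositional.Properties as Perm
open import Data.List.Relation.Unary.Any using (here)
open import Data.List.Relation.Unary.All as All using (All; []; _∷_)
import Data.List.Relation.Unary.All.Properties as AllP
open import Data.List.Relation.Unary.AllPairs as AllPairs using (AllPairs; []; _∷_; allPairs?)
import Data.List.Relation.Unary.AllPairs.Properties as AllPairsP
open import Data.List.Relation.Unary.Unique.Propositional using (Unique)
import Data.List.Relation.Unary.Unique.Propositional.Properties as UniqueP
open import Data.Product using (_×_; _,_; proj₁; proj₂; ∃-syntax)
open import Data.Sum using (inj₁; inj₂)
open import Data.Unit using (⊤; tt)
open import Data.Empty using (⊥-elim)
open import Function using (_∘_; flip; id)
open import Function.Bundles using (mk⇔)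
open import Relation.Nullary using (¬_; Dec; yes; no; ¬?)
open import Relation.Nullary.Decidable using (_×-dec_)
open import Relation.Binary.PropositionalEquality

+-interchange : ∀ a b c d → a + b + (c + d) ≡ a + c + (b + d)
+-interchange = interchange +-commutativeSemigroup

+-swap : ∀ a b c → a + (b + c) ≡ b + (a + c)
+-swap = x∙yz≈y∙xz +-commutativeSemigroup

*-swap : ∀ a b c → a * (b * c) ≡ b * (a * c)
*-swap = x∙yz≈y∙xz *-commutativeSemigroup

-- Indicators and finite sums

𝟙 : ∀ {P : Set} → Dec P → ℕ
𝟙 (yes _) = 1
𝟙 (no _)  = 0

𝟙-yes : ∀ {P : Set} (d : Dec P) → P → 𝟙 d ≡ 1
𝟙-yes (yes _) _ = refl
𝟙-yes (no ¬p) p = ⊥-elim (¬p p)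

𝟙-no : ∀ {P : Set} (d : Dec P) → ¬ P → 𝟙 d ≡ 0
𝟙-no (yes p) ¬p = ⊥-elim (¬p p)
𝟙-no (no _)  _  = refl

𝟙≤1 : ∀ {P : Set} (d : Dec P) → 𝟙 d ≤ 1
𝟙≤1 (yes _) = ≤-refl
𝟙≤1 (no _)  = z≤n

𝟙-mono : ∀ {P Q : Set} (d : Dec P) (e : Dec Q) → (P → Q) → 𝟙 d ≤ 𝟙 e
𝟙-mono (no _)  _ _ = z≤n
𝟙-mono (yes p) e f = ≤-reflexive (sym (𝟙-yes e (f p)))

𝟙-cong : ∀ {P Q : Set} (d : Dec P) (e : Dec Q) → (P → Q) → (Q → P) → 𝟙 d ≡ 𝟙 e
𝟙-cong d e f g = ≤-antisym (𝟙-mono d e f) (𝟙-mono e d g)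

𝟙*-mono : ∀ {P : Set} (d : Dec P) {a b : ℕ} → (P → a ≤ b) → 𝟙 d * a ≤ 𝟙 d * b
𝟙*-mono (yes p) f = *-monoʳ-≤ 1 (f p)
𝟙*-mono (no _)  _ = z≤n

Σ< : ℕ → (ℕ → ℕ) → ℕ
Σ< zero    f = 0
Σ< (suc b) f = f 0 + Σ< b (f ∘ suc)

Σ-cong : ∀ b {f g : ℕ → ℕ} → (∀ a → f a ≡ g a) → Σ< b f ≡ Σ< b g
Σ-cong zero    e = refl
Σ-cong (suc b) e = cong₂ _+_ (e 0) (Σ-cong b (e ∘ suc))

Σ-mono : ∀ b {f g : ℕ → ℕ} → (∀ a → a < b → f a ≤ g a) → Σ< b f ≤ Σ< b g
Σ-mono zero    e = z≤n
Σ-mono (suc b) e = +-mono-≤ (e 0 z<s) (Σ-mono b (λ a a<b → e (suc a) (s<s a<b)))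

Σ-+ : ∀ b (f g : ℕ → ℕ) → Σ< b (λ a → f a + g a) ≡ Σ< b f + Σ< b g
Σ-+ zero    f g = refl
Σ-+ (suc b) f g = trans (cong (f 0 + g 0 +_) (Σ-+ b (f ∘ suc) (g ∘ suc)))
  (+-interchange (f 0) (g 0) _ _)

Σ-* : ∀ b c (f : ℕ → ℕ) → Σ< b (λ a → c * f a) ≡ c * Σ< b f
Σ-* zero    c f = sym (*-zeroʳ c)
Σ-* (suc b) c f = trans (cong (c * f 0 +_) (Σ-* b c (f ∘ suc)))
  (sym (*-distribˡ-+ c (f 0) _))

Σ-zero : ∀ b → Σ< b (λ _ → 0) ≡ 0
Σ-zero zero    = refl
Σ-zero (suc b) = Σ-zero b

Σ-swap : ∀ b c (f : ℕ → ℕ → ℕ) → Σ< b (λ x → Σ< c (f x)) ≡ Σ< c (λ y → Σ< b (λ x → f x y))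
Σ-swap zero    c f = sym (Σ-zero c)
Σ-swap (suc b) c f = trans (cong (Σ< c (f 0) +_) (Σ-swap b c (f ∘ suc)))
  (sym (Σ-+ c (f 0) _))

Σ-split : ∀ b c (f : ℕ → ℕ) → Σ< (b + c) f ≡ Σ< b f + Σ< c (λ a → f (b + a))
Σ-split zero    c f = refl
Σ-split (suc b) c f = trans (cong (f 0 +_) (Σ-split b c (f ∘ suc))) (sym (+-assoc (f 0) _ _))

Σ-prefix : ∀ {b c} → b ≤ c → (f : ℕ → ℕ) → Σ< b f ≤ Σ< c f
Σ-prefix z≤n     f = z≤n
Σ-prefix (s≤s p) f = +-monoʳ-≤ (f 0) (Σ-prefix p (f ∘ suc))

Σ-window : ∀ {b c B} → b + c ≤ B → (f : ℕ → ℕ) → Σ< c (λ a → f (b + a)) ≤ Σ< B f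
Σ-window {b} {c} p f = ≤-trans (m≤n+m _ (Σ< b f))
  (≤-trans (≤-reflexive (sym (Σ-split b c f))) (Σ-prefix p f))

Σ-shift : ∀ b (f : ℕ → ℕ) → Σ< b f ≤ f 0 + Σ< b (f ∘ suc)
Σ-shift b f = Σ-prefix (n≤1+n b) f

Σ-const : ∀ b c → Σ< b (λ _ → c) ≡ b * c
Σ-const zero    c = refl
Σ-const (suc b) c = cong (c +_) (Σ-const b c)

Σ-𝟙< : ∀ b w → Σ< b (λ y → 𝟙 (y <? w)) ≤ w
Σ-𝟙< zero    w       = z≤n
Σ-𝟙< (suc b) zero    = ≤-reflexive (trans (Σ-cong b (λ a → 𝟙-no (suc a <? 0) λ ())) (Σ-zero b))
Σ-𝟙< (suc b) (suc w) = s≤s (≤-trans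
  (Σ-mono b (λ a _ → 𝟙-mono (suc a <? suc w) (a <? w) s<s⁻¹)) (Σ-𝟙< b w))

Σ-𝟙-interval : ∀ b u w → Σ< b (λ y → 𝟙 ((u ≤? y) ×-dec (y <? u + w))) ≤ w
Σ-𝟙-interval b       zero    w = ≤-trans
  (Σ-mono b (λ y _ → 𝟙-mono ((0 ≤? y) ×-dec (y <? w)) (y <? w) λ (_ , q) → q)) (Σ-𝟙< b w)
Σ-𝟙-interval zero    (suc u) w = z≤n
Σ-𝟙-interval (suc b) (suc u) w = ≤-trans
  (Σ-mono b (λ y _ → 𝟙-mono ((suc u ≤? suc y) ×-dec (suc y <? suc u + w))
    ((u ≤? y) ×-dec (y <? u + w)) λ (p , q) → s≤s⁻¹ p , s<s⁻¹ q))
  (Σ-𝟙-interval b u w)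

-- Sums over codes: the i-th entry of a code ranges below the i-th size.

G : List ℕ → (ℕ → ℕ) → ℕ
G []       φ = φ 0
G (b ∷ bs) φ = Σ< b (λ a → G bs (λ s → φ (a + s)))

G-cong : ∀ bs {φ ψ : ℕ → ℕ} → (∀ s → φ s ≡ ψ s) → G bs φ ≡ G bs ψ
G-cong []       e = e 0
G-cong (b ∷ bs) e = Σ-cong b (λ a → G-cong bs (λ s → e (a + s)))

G-mono : ∀ bs {φ ψ : ℕ → ℕ} → (∀ s → φ s ≤ ψ s) → G bs φ ≤ G bs ψ
G-mono []       e = e 0
G-mono (b ∷ bs) e = Σ-mono b (λ a _ → G-mono bs (λ s → e (a + s)))

G-+ : ∀ bs (φ ψ : ℕ → ℕ) → G bs (λ s → φ s + ψ s) ≡ G bs φ + G bs ψ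
G-+ []       φ ψ = refl
G-+ (b ∷ bs) φ ψ = trans (Σ-cong b (λ a → G-+ bs (λ s → φ (a + s)) (λ s → ψ (a + s)))) (Σ-+ b _ _)

G-* : ∀ bs c (φ : ℕ → ℕ) → G bs (λ s → c * φ s) ≡ c * G bs φ
G-* []       c φ = refl
G-* (b ∷ bs) c φ = trans (Σ-cong b (λ a → G-* bs c (λ s → φ (a + s)))) (Σ-* b c _)

-- Double counting of (code, marked unit), the unit being removed.
G-remove-unit : ∀ bs (φ : ℕ → ℕ) →
  G bs (λ s → s * φ s) ≤ G bs (λ s → (s + length bs) * φ (suc s))
G-remove-unit []       φ = z≤n
G-remove-unit (b ∷ bs) φ = begin
  Σ< b (λ a → G bs (λ s → (a + s) * φ (a + s)))
    ≡⟨ Σ-cong b (λ a → trans (G-cong bs (λ s → *-distribʳ-+ (φ (a + s)) a s))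
         (trans (G-+ bs _ _) (cong (_+ G bs (λ s → s * φ (a + s))) (G-* bs a _)))) ⟩
  Σ< b (λ a → a * g a + G bs (λ s → s * φ (a + s)))
    ≤⟨ Σ-mono b (λ a _ → +-monoʳ-≤ (a * g a) (G-remove-unit bs (λ s → φ (a + s)))) ⟩
  Σ< b (λ a → a * g a + G bs (λ s → (s + N) * φ (a + suc s)))
    ≡⟨ Σ-+ b _ _ ⟩
  Σ< b (λ a → a * g a) + Σ< b (λ a → G bs (λ s → (s + N) * φ (a + suc s)))
    -- The term at a = 0 vanishes, so the shift loses nothing. It may add the value a = b, where the
    -- unit put back leaves the range; hence an inequality.
    ≤⟨ +-monoˡ-≤ _ (Σ-shift b (λ a → a * g a)) ⟩
  Σ< b (λ a → suc a * g (suc a)) + Σ< b (λ a → G bs (λ s → (s + N) * φ (a + suc s)))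
    ≡⟨ Σ-+ b _ _ ⟨
  Σ< b (λ a → suc a * g (suc a) + G bs (λ s → (s + N) * φ (a + suc s)))
    ≡⟨ Σ-cong b (λ a → trans (cong (_+ G bs (λ s → (s + N) * φ (a + suc s))) (sym (G-* bs (suc a) _)))
         (trans (sym (G-+ bs _ _)) (G-cong bs (λ s → merge a s)))) ⟩
  Σ< b (λ a → G bs (λ s → (a + s + suc N) * φ (suc (a + s)))) ∎
  where
  open ≤-Reasoning
  N = length bs
  g : ℕ → ℕ
  g a = G bs (λ s → φ (a + s))
  factor : ∀ a s n p → suc a * p + (s + n) * p ≡ (a + s + suc n) * p
  factor = solve-∀
  merge : ∀ a s → suc a * φ (suc (a + s)) + (s + N) * φ (a + suc s) ≡ (a + s + suc N) * φ (suc (a + s))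
  merge a s = trans (cong (λ t → suc a * φ (suc (a + s)) + (s + N) * φ t) (+-suc a s))
    (factor a s N (φ (suc (a + s))))

-- Size at least `h + h` is what lets an entry that holds fewer than h units receive h more without
-- leaving its range.
big : ℕ → List ℕ → ℕ
big h []       = 0
big h (b ∷ bs) = 𝟙 (h + h ≤? b) + big h bs

-- The one-entry case of block insertion. If h + a < b, the block fits on top of a: the new entry h
-- + a is at least h, which pays with a term of the second sum. Otherwise a ≥ b - h ≥ h, so a itself
-- is at least h and pays with a term of the first.
Σ-move : ∀ h b → h + h ≤ b → (g : ℕ → ℕ) →
  h * Σ< b (λ a → g (h + a)) ≤ Σ< b (λ a → a * g (h + a)) + Σ< b (λ a → a * g a)
Σ-move h b 2h≤b g with d , refl ← m≤n⇒∃[o]m+o≡n 2h≤b = begin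
  h * Σ< b (λ a → g (h + a))
    ≡⟨ cong (λ c → h * Σ< c (λ a → g (h + a))) (arith h d) ⟩
  h * Σ< (h + d + h) (λ a → g (h + a))
    ≡⟨ cong (h *_) (Σ-split (h + d) h _) ⟩
  h * (Σ< (h + d) (λ a → g (h + a)) + Σ< h (λ a → g (h + (h + d + a))))
    ≡⟨ trans (*-distribˡ-+ h _ _) (sym (cong₂ _+_ (Σ-* (h + d) h _) (Σ-* h h _))) ⟩
  Σ< (h + d) (λ a → h * g (h + a)) + Σ< h (λ a → h * g (h + (h + d + a)))
    ≤⟨ +-mono-≤ (Σ-mono (h + d) (λ a _ → *-monoˡ-≤ (g (h + a)) (m≤m+n h a)))
         (Σ-mono h (λ a _ → *-monoˡ-≤ (g (h + (h + d + a))) (≤-trans (m≤m+n h d) (m≤m+n (h + d) a)))) ⟩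
  Σ< (h + d) (λ a → (h + a) * g (h + a)) + Σ< h (λ a → (h + d + a) * g (h + (h + d + a)))
    ≤⟨ +-mono-≤ (Σ-window {h} {h + d} (≤-reflexive (sym (+-assoc h h d))) (λ a → a * g a))
         (Σ-window {h + d} {h} (≤-reflexive (sym (arith h d))) (λ a → a * g (h + a))) ⟩
  Σ< b (λ a → a * g a) + Σ< b (λ a → a * g (h + a))
    ≡⟨ +-comm (Σ< b (λ a → a * g a)) _ ⟩
  Σ< b (λ a → a * g (h + a)) + Σ< b (λ a → a * g a) ∎
  where
  open ≤-Reasoning
  arith : ∀ h d → h + h + d ≡ h + d + h
  arith = solve-∀

-- A block of h units is moved into an entry that holds fewer than h of them;
-- at most s / h entries of a code of sum s can hold h or more.
G-insert-block : ∀ h bs (φ : ℕ → ℕ) →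
  h * big h bs * G bs (λ s → φ (h + s)) ≤ G bs (λ s → s * φ (h + s)) + G bs (λ s → s * φ s)
G-insert-block h []       φ = ≤-reflexive (cong (_* φ (h + 0)) (*-zeroʳ h))
G-insert-block h (b ∷ bs) φ = begin
  h * (𝟙 d + B) * Σ< b (λ a → G bs (λ s → φ (h + (a + s))))
    ≡⟨ cong (h * (𝟙 d + B) *_) (Σ-cong b (λ a → G-cong bs (λ s → cong φ (sym (+-assoc h a s))))) ⟩
  h * (𝟙 d + B) * Σ< b (λ a → g (h + a))
    ≡⟨ distrib h (𝟙 d) B _ ⟩
  𝟙 d * (h * Σ< b (λ a → g (h + a))) + h * B * Σ< b (λ a → g (h + a))
    ≤⟨ +-mono-≤ (head d) tail ⟩
  Σ< b (λ a → a * g (h + a)) + Σ< b (λ a → a * g a) +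
    (Σ< b (λ a → G bs (λ s → s * φ (h + (a + s)))) + Σ< b (λ a → G bs (λ s → s * φ (a + s))))
    ≡⟨ +-interchange (Σ< b (λ a → a * g (h + a))) (Σ< b (λ a → a * g a))
         (Σ< b (λ a → G bs (λ s → s * φ (h + (a + s))))) _ ⟩
  Σ< b (λ a → a * g (h + a)) + Σ< b (λ a → G bs (λ s → s * φ (h + (a + s)))) +
    (Σ< b (λ a → a * g a) + Σ< b (λ a → G bs (λ s → s * φ (a + s))))
    ≡⟨ cong₂ _+_ (trans (cong (_+ Σ< b (λ a → G bs (λ s → s * φ (h + (a + s))))) (Σ-cong b λ a → cong (a *_)
          (G-cong bs (λ s → cong φ (+-assoc h a s))))) (join (λ t → φ (h + t)))) (join φ) ⟩
  Σ< b (λ a → G bs (λ s → (a + s) * φ (h + (a + s)))) + Σ< b (λ a → G bs (λ s → (a + s) * φ (a + s))) ∎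
  where
  open ≤-Reasoning
  B = big h bs
  d = h + h ≤? b
  g : ℕ → ℕ
  g a = G bs (λ s → φ (a + s))
  distrib : ∀ h e c x → h * (e + c) * x ≡ e * (h * x) + h * c * x
  distrib = solve-∀
  head : (e : Dec (h + h ≤ b)) → 𝟙 e * (h * Σ< b (λ a → g (h + a)))
    ≤ Σ< b (λ a → a * g (h + a)) + Σ< b (λ a → a * g a)
  head (yes p) = ≤-trans (≤-reflexive (*-identityˡ _)) (Σ-move h b p g)
  head (no _)  = z≤n
  tail : h * B * Σ< b (λ a → g (h + a))
    ≤ Σ< b (λ a → G bs (λ s → s * φ (h + (a + s)))) + Σ< b (λ a → G bs (λ s → s * φ (a + s)))
  tail = begin
    h * B * Σ< b (λ a → g (h + a)) ≡⟨ Σ-* b (h * B) _ ⟨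
    Σ< b (λ a → h * B * g (h + a))
      ≡⟨ Σ-cong b (λ a → cong (h * B *_) (G-cong bs (λ s → cong φ (perm h a s)))) ⟩
    Σ< b (λ a → h * B * G bs (λ s → φ (a + (h + s))))
      ≤⟨ Σ-mono b (λ a _ → G-insert-block h bs (λ s → φ (a + s))) ⟩
    Σ< b (λ a → G bs (λ s → s * φ (a + (h + s))) + G bs (λ s → s * φ (a + s)))
      ≡⟨ Σ-+ b _ _ ⟩
    Σ< b (λ a → G bs (λ s → s * φ (a + (h + s)))) + Σ< b (λ a → G bs (λ s → s * φ (a + s)))
      ≡⟨ cong (_+ Σ< b (λ a → G bs (λ s → s * φ (a + s)))) (Σ-cong b (λ a → G-cong bs (λ s → cong (λ t → s * φ t) (+-swap a h s)))) ⟩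
    Σ< b (λ a → G bs (λ s → s * φ (h + (a + s)))) + Σ< b (λ a → G bs (λ s → s * φ (a + s))) ∎
    where
    perm : ∀ h a s → h + a + s ≡ a + (h + s)
    perm = solve-∀
  join : ∀ (ψ : ℕ → ℕ) → Σ< b (λ a → a * G bs (λ s → ψ (a + s))) + Σ< b (λ a → G bs (λ s → s * ψ (a + s)))
    ≡ Σ< b (λ a → G bs (λ s → (a + s) * ψ (a + s)))
  join ψ = trans (sym (Σ-+ b _ _)) (Σ-cong b (λ a → trans (cong (_+ G bs (λ s → s * ψ (a + s))) (sym (G-* bs a _)))
    (trans (sym (G-+ bs _ _)) (G-cong bs (λ s → sym (*-distribʳ-+ (ψ (a + s)) a s))))))

-- To derive A ≤ B from X ≤ Y when B - A = (Y - X) + slack, as a ring identity.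
linear : ∀ {X Y A B} slack → X ≤ Y → A + Y + slack ≡ B + X → A ≤ B
linear {X} {Y} {A} {B} slack X≤Y eq = +-cancelʳ-≤ Y A B
  (≤-trans (m≤m+n (A + Y) slack) (≤-trans (≤-reflexive eq) (+-monoʳ-≤ B X≤Y)))

-- Codes of prescribed sum: tails and slow variation

δ : ℕ → ℕ → ℕ
δ m s = 𝟙 (s ≟ m)

δ-at : ∀ m s (f g : ℕ) → (s ≡ m → f ≤ g) → f * δ m s ≤ g * δ m s
δ-at m s f g f≤g with s ≟ m
... | yes e = *-monoˡ-≤ 1 (f≤g e)
... | no  _ = ≤-reflexive (trans (*-zeroʳ f) (sym (*-zeroʳ g)))

-- The number of codes of sum m - z (0 if z > m).
V : List ℕ → ℕ → ℕ → ℕ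
V bs m z = G bs (λ s → δ m (z + s))

weighted≤ : ∀ bs m z → G bs (λ s → s * δ m (z + s)) ≤ m * V bs m z
weighted≤ bs m z = ≤-trans
  (G-mono bs (λ s → δ-at m (z + s) s m (λ e → ≤-trans (m≤n+m s z) (≤-reflexive e))))
  (≤-reflexive (G-* bs m _))

-- On the support of `δ` the weights in `G-insert-block` are at most m. Thus V at h + u is small
-- against V at u as soon as `h * big h bs` is much larger than m.
V-insert-block : ∀ bs m h u → h * big h bs * V bs m (h + u) ≤ m * V bs m (h + u) + m * V bs m u
V-insert-block bs m h u = begin
  h * big h bs * V bs m (h + u)
    ≡⟨ cong (h * big h bs *_) (G-cong bs (λ s → cong (δ m) (perm h u s))) ⟩
  h * big h bs * G bs (λ s → δ m (u + (h + s)))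
    ≤⟨ G-insert-block h bs (λ s → δ m (u + s)) ⟩
  G bs (λ s → s * δ m (u + (h + s))) + G bs (λ s → s * δ m (u + s))
    ≡⟨ cong (_+ G bs (λ s → s * δ m (u + s)))
         (G-cong bs (λ s → cong (λ t → s * δ m t) (sym (perm h u s)))) ⟩
  G bs (λ s → s * δ m (h + u + s)) + G bs (λ s → s * δ m (u + s))
    ≤⟨ +-mono-≤ (weighted≤ bs m (h + u)) (weighted≤ bs m u) ⟩
  m * V bs m (h + u) + m * V bs m u ∎
  where
  open ≤-Reasoning
  perm : ∀ h u s → h + u + s ≡ u + (h + s)
  perm = solve-∀

-- Here x is the value of a further entry of size b. Summing `V-insert-block` over x = h + u bounds
-- the left side by two partial sums of V over x < b, each with weight m.
tail-bound : ∀ bs m h b →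
  h * big h bs * Σ< b (λ x → 𝟙 (h ≤? x) * V bs m x) ≤ 2 * m * Σ< b (V bs m)
tail-bound bs m h b with h ≤? b
... | no h≰b = ≤-trans (≤-reflexive (trans (cong (h * big h bs *_)
        (n≤0⇒n≡0 (≤-trans (Σ-mono b small) (≤-reflexive (Σ-zero b))))) (*-zeroʳ (h * big h bs)))) z≤n
  where
  small : ∀ a → a < b → 𝟙 (h ≤? a) * V bs m a ≤ 0
  small a a<b = ≤-reflexive (cong (_* V bs m a)
    (𝟙-no (h ≤? a) (λ h≤a → h≰b (≤-trans h≤a (<⇒≤ a<b)))))
... | yes h≤b with d , refl ← m≤n⇒∃[o]m+o≡n h≤b = begin
  c * Σ< (h + d) (λ x → 𝟙 (h ≤? x) * V bs m x)
    ≡⟨ cong (c *_) (Σ-split h d _) ⟩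
  c * (Σ< h (λ x → 𝟙 (h ≤? x) * V bs m x) + Σ< d (λ u → 𝟙 (h ≤? h + u) * V bs m (h + u)))
    ≤⟨ *-monoʳ-≤ c (+-mono-≤ (≤-trans (Σ-mono h below) (≤-reflexive (Σ-zero h)))
         (Σ-mono d (λ u _ → ≤-trans (*-monoˡ-≤ (V bs m (h + u)) (𝟙≤1 (h ≤? h + u))) (≤-reflexive (*-identityˡ _))))) ⟩
  c * Σ< d (λ u → V bs m (h + u))
    ≡⟨ Σ-* d c _ ⟨
  Σ< d (λ u → c * V bs m (h + u))
    ≤⟨ Σ-mono d (λ u _ → V-insert-block bs m h u) ⟩
  Σ< d (λ u → m * V bs m (h + u) + m * V bs m u)
    ≡⟨ trans (Σ-+ d _ _) (cong₂ _+_ (Σ-* d m _) (Σ-* d m _)) ⟩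
  m * Σ< d (λ u → V bs m (h + u)) + m * Σ< d (V bs m)
    ≤⟨ +-mono-≤ (*-monoʳ-≤ m (Σ-window {h} {d} ≤-refl (V bs m)))
         (*-monoʳ-≤ m (Σ-prefix (m≤n+m d h) (V bs m))) ⟩
  m * Σ< (h + d) (V bs m) + m * Σ< (h + d) (V bs m)
    ≡⟨ double m _ ⟩
  2 * m * Σ< (h + d) (V bs m) ∎
  where
  open ≤-Reasoning
  c = h * big h bs
  double : ∀ m t → m * t + m * t ≡ 2 * m * t
  double = solve-∀
  below : ∀ a → a < h → 𝟙 (h ≤? a) * V bs m a ≤ 0
  below a a<h = ≤-reflexive (cong (_* V bs m a) (𝟙-no (h ≤? a) (<⇒≱ a<h)))

V-remove-unit : ∀ bs m z M → z + M ≡ m → M * V bs m z ≤ (M + length bs) * V bs m (suc z)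
V-remove-unit bs m z M e = begin
  M * V bs m z ≡⟨ G-* bs M _ ⟨
  G bs (λ s → M * δ m (z + s))
    ≤⟨ G-mono bs (λ s → δ-at m (z + s) M s (λ e′ → ≤-reflexive (+-cancelˡ-≡ z M s (trans e (sym e′))))) ⟩
  G bs (λ s → s * δ m (z + s))
    ≤⟨ G-remove-unit bs (λ s → δ m (z + s)) ⟩
  G bs (λ s → (s + N) * δ m (z + suc s))
    -- On the support s = M - 1; the weight is rounded up to M + N.
    ≤⟨ G-mono bs (λ s → δ-at m (z + suc s) (s + N) (M + N) (λ e′ → +-monoˡ-≤ N (≤-trans (n≤1+n s)
         (≤-reflexive (+-cancelˡ-≡ z (suc s) M (trans e′ (sym e))))))) ⟩
  G bs (λ s → (M + N) * δ m (z + suc s))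
    ≡⟨ G-cong bs (λ s → cong (λ t → (M + N) * δ m t) (+-suc z s)) ⟩
  G bs (λ s → (M + N) * δ m (suc z + s))
    ≡⟨ G-* bs (M + N) _ ⟩
  (M + N) * V bs m (suc z) ∎
  where
  open ≤-Reasoning
  N = length bs

-- With M' = m - z units on the entries, `V-remove-unit` loses a factor (M' + N) / M', which is at
-- most 1 + 1/p once p N ≤ M ≤ M'. Only a lower bound M on M' is asked for, so that the same p
-- serves along a whole range of z.
V-step : ∀ bs m z M p → z + M ≤ m → p * length bs ≤ M → 0 < M →
  p * V bs m z ≤ suc p * V bs m (suc z)
V-step bs m z M p z+M≤m pN≤M 0<M with d , refl ← m≤n⇒∃[o]m+o≡n z+M≤m =
  *-cancelˡ-≤ M′ (begin
    M′ * (p * V bs m z)                        ≡⟨ *-swap M′ p _ ⟩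
    p * (M′ * V bs m z)                        ≤⟨ *-monoʳ-≤ p (V-remove-unit bs m z M′ (sym (+-assoc z M d))) ⟩
    p * ((M′ + N) * V bs m (suc z))            ≡⟨ expand p M′ N _ ⟩
    (p * N) * V bs m (suc z) + p * M′ * V bs m (suc z)
      ≤⟨ +-monoˡ-≤ _ (*-monoˡ-≤ (V bs m (suc z)) (≤-trans pN≤M (m≤m+n M d))) ⟩
    M′ * V bs m (suc z) + p * M′ * V bs m (suc z) ≡⟨ collect p M′ _ ⟩
    M′ * (suc p * V bs m (suc z)) ∎)
  where
  open ≤-Reasoning
  M′ = M + d
  N = length bs
  instance
    M′≢0 : NonZero (M + d)
    M′≢0 = >-nonZero (≤-trans 0<M (m≤m+n M d))
  expand : ∀ p a n v → p * ((a + n) * v) ≡ p * n * v + p * a * v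
  expand = solve-∀
  collect : ∀ p a v → a * v + p * a * v ≡ a * (suc p * v)
  collect = solve-∀

-- Bernoulli's inequality: i steps with factor 1 - 1/(p + 1) leave at least 1 - i/(p + 1), which is
-- d/(p + 1). The induction step reduces to d ≤ p.
V-decay : ∀ bs m z M p i d → i + d ≡ suc p → z + i + M ≤ m → p * length bs ≤ M → 0 < M →
  d * V bs m z ≤ suc p * V bs m (z + i)
V-decay bs m z M p zero    d refl _ _ _ = ≤-reflexive (cong (λ t → suc p * V bs m t) (sym (+-identityʳ z)))
V-decay bs m z M p (suc i) d e z+i+M≤m pN≤M 0<M = *-cancelˡ-≤ (suc p) (begin
  suc p * (d * V bs m z)             ≡⟨ *-assoc (suc p) d _ ⟨
  suc p * d * V bs m z               ≤⟨ *-monoˡ-≤ (V bs m z) (linear 0 d≤p (arith p d)) ⟩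
  p * suc d * V bs m z               ≡⟨ *-assoc p (suc d) _ ⟩
  p * (suc d * V bs m z)
    ≤⟨ *-monoʳ-≤ p (V-decay bs m z M p i (suc d) (trans (+-suc i d) e)
         (≤-trans (+-monoˡ-≤ M (+-monoʳ-≤ z (n≤1+n i))) z+i+M≤m) pN≤M 0<M) ⟩
  p * (suc p * V bs m (z + i))       ≡⟨ *-swap p (suc p) _ ⟩
  suc p * (p * V bs m (z + i))
    ≤⟨ *-monoʳ-≤ (suc p) (V-step bs m (z + i) M p
         (≤-trans (+-monoˡ-≤ M (+-monoʳ-≤ z (n≤1+n i))) z+i+M≤m) pN≤M 0<M) ⟩
  suc p * (suc p * V bs m (suc (z + i))) ≡⟨ cong (λ t → suc p * (suc p * V bs m t)) (+-suc z i) ⟨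
  suc p * (suc p * V bs m (z + suc i)) ∎)
  where
  open ≤-Reasoning
  d≤p : d ≤ p
  d≤p = ≤-trans (m≤n+m d i) (≤-reflexive (suc-injective e))
  arith : ∀ p d → suc p * d + p + 0 ≡ p * suc d + d
  arith = solve-∀

-- `V-decay` with p = 2r: for i ≤ r the surviving fraction (2r + 1 - i)/(2r + 1) exceeds one half.
V-halving : ∀ bs m z M r i → i ≤ r → z + r + M ≤ m → 2 * r * length bs ≤ M → 0 < M →
  V bs m z ≤ 2 * V bs m (z + i)
V-halving bs m z M r i i≤r le rN≤M 0<M with e , refl ← m≤n⇒∃[o]m+o≡n i≤r = *-cancelˡ-≤ (suc (2 * r)) (begin
  suc (2 * r) * V bs m z      ≤⟨ *-monoˡ-≤ (V bs m z) (linear {0} {0} (suc (2 * e)) z≤n (arith₁ i e)) ⟩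
  2 * suc (i + 2 * e) * V bs m z ≡⟨ *-assoc 2 (suc (i + 2 * e)) _ ⟩
  2 * (suc (i + 2 * e) * V bs m z)
    ≤⟨ *-monoʳ-≤ 2 (V-decay bs m z M (2 * r) i (suc (i + 2 * e)) (arith₂ i e)
         (≤-trans (+-monoˡ-≤ M (+-monoʳ-≤ z i≤r)) le) rN≤M 0<M) ⟩
  2 * (suc (2 * r) * V bs m (z + i)) ≡⟨ *-swap 2 (suc (2 * r)) (V bs m (z + i)) ⟩
  suc (2 * r) * (2 * V bs m (z + i)) ∎)
  where
  open ≤-Reasoning
  arith₁ : ∀ i e → suc (2 * (i + e)) + 0 + suc (2 * e) ≡ 2 * suc (i + 2 * e) + 0
  arith₁ = solve-∀
  arith₂ : ∀ i e → i + suc (i + 2 * e) ≡ suc (2 * (i + e))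
  arith₂ = solve-∀

-- Two distinguished entries x < Y + k and y < Y; the other sizes are bs.
module Joint (bs : List ℕ) (m Y k : ℕ) where

  v : ℕ → ℕ
  v = V bs m

  -- The weight `v (x + y)` counts the completions by the other entries. It is symmetric in x and y,
  -- which is what allows the exchange.
  A : (ℕ → ℕ → ℕ) → ℕ
  A g = Σ< (Y + k) (λ x → Σ< Y (λ y → g x y * v (x + y)))

  total : ℕ
  total = A (λ _ _ → 1)

  tail : ℕ → ℕ
  tail H = A (λ x _ → 𝟙 (H ≤? x))

  near : ℕ → ℕ → ℕ
  near x y = 𝟙 ((x <? y + k) ×-dec (y <? x + k))

  A-mono : ∀ {g g′} → (∀ x y → y < Y → g x y ≤ g′ x y) → A g ≤ A g′
  A-mono le = Σ-mono (Y + k) (λ x _ → Σ-mono Y (λ y y<Y → *-monoˡ-≤ (v (x + y)) (le x y y<Y)))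

  A-+ : ∀ g g′ → A (λ x y → g x y + g′ x y) ≡ A g + A g′
  A-+ g g′ = trans (Σ-cong (Y + k) (λ x → trans (Σ-cong Y (λ y → *-distribʳ-+ (v (x + y)) (g x y) (g′ x y)))
    (Σ-+ Y _ _))) (Σ-+ (Y + k) _ _)

  -- On the square x, y < Y the two entries can be exchanged. In the remaining strip x ≥ Y they
  -- cannot, but there x ≥ H, so the tail absorbs it.
  A-flip : ∀ H g → H ≤ Y → (∀ x y → g x y ≤ 1) → A g ≤ A (flip g) + tail H
  A-flip H g H≤Y g≤1 = begin
    A g ≡⟨ Σ-split Y k _ ⟩
    Σ< Y (λ x → Σ< Y (λ y → g x y * v (x + y))) + Σ< k (λ x → Σ< Y (λ y → g (Y + x) y * v (Y + x + y)))
      ≤⟨ +-mono-≤ square (Σ-mono k (λ x _ → Σ-mono Y (λ y _ → *-monoˡ-≤ (v (Y + x + y)) (outside x y)))) ⟩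
    A (flip g) + Σ< k (λ x → Σ< Y (λ y → 𝟙 (H ≤? Y + x) * v (Y + x + y)))
      ≤⟨ +-monoʳ-≤ (A (flip g)) (Σ-window {Y} {k} ≤-refl (λ x → Σ< Y (λ y → 𝟙 (H ≤? x) * v (x + y)))) ⟩
    A (flip g) + tail H ∎
    where
    open ≤-Reasoning
    square : Σ< Y (λ x → Σ< Y (λ y → g x y * v (x + y))) ≤ A (flip g)
    square = ≤-trans (≤-reflexive (trans (Σ-swap Y Y _)
      (Σ-cong Y (λ y → Σ-cong Y (λ x → cong (λ t → g x y * v t) (+-comm x y))))))
      (Σ-prefix (m≤m+n Y k) (λ x → Σ< Y (λ y → g y x * v (x + y))))
    outside : ∀ x y → g (Y + x) y ≤ 𝟙 (H ≤? Y + x)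
    outside x y = ≤-trans (g≤1 (Y + x) y) (≤-reflexive (sym (𝟙-yes (H ≤? Y + x) (≤-trans H≤Y (m≤m+n Y x)))))

  -- The event y < x and its mirror image are disjoint, and `A-flip` compares them.
  upper : ∀ H → H ≤ Y → 2 * A (λ x y → 𝟙 (y <? x)) ≤ total + tail H
  upper H H≤Y = begin
    2 * D                        ≡⟨ cong (D +_) (+-identityʳ D) ⟩
    D + D                        ≤⟨ +-monoʳ-≤ D (A-flip H _ H≤Y (λ x y → 𝟙≤1 (y <? x))) ⟩
    D + (A (λ x y → 𝟙 (x <? y)) + tail H) ≡⟨ +-assoc D _ _ ⟨
    D + A (λ x y → 𝟙 (x <? y)) + tail H   ≡⟨ cong (_+ tail H)
      (sym (A-+ (λ x y → 𝟙 (y <? x)) (λ x y → 𝟙 (x <? y)))) ⟩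
    A (λ x y → 𝟙 (y <? x) + 𝟙 (x <? y)) + tail H
      ≤⟨ +-monoˡ-≤ (tail H) (A-mono (λ x y _ → exclusive x y)) ⟩
    total + tail H ∎
    where
    open ≤-Reasoning
    D = A (λ x y → 𝟙 (y <? x))
    exclusive : ∀ x y → 𝟙 (y <? x) + 𝟙 (x <? y) ≤ 1
    exclusive x y with y <? x
    ... | yes y<x = ≤-reflexive (cong suc (𝟙-no (x <? y) (<⇒≯ y<x)))
    ... | no _    = 𝟙≤1 (x <? y)

  -- The events y + k ≤ x, x + k ≤ y and `near` cover all pairs; `A-flip` replaces the second by the
  -- first.
  lower : ∀ H → H ≤ Y → total ≤ 2 * A (λ x y → 𝟙 (y + k ≤? x)) + (A near + tail H)
  lower H H≤Y = begin
    total
      ≤⟨ A-mono (λ x y _ → cover x y) ⟩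
    A (λ x y → 𝟙 (y + k ≤? x) + 𝟙 (x + k ≤? y) + near x y)
      ≡⟨ trans (A-+ (λ x y → 𝟙 (y + k ≤? x) + 𝟙 (x + k ≤? y)) near)
           (cong (_+ A near) (A-+ (λ x y → 𝟙 (y + k ≤? x)) (λ x y → 𝟙 (x + k ≤? y)))) ⟩
    D + A (λ x y → 𝟙 (x + k ≤? y)) + A near
      ≤⟨ +-monoˡ-≤ (A near) (+-monoʳ-≤ D (A-flip H _ H≤Y (λ x y → 𝟙≤1 (x + k ≤? y)))) ⟩
    D + (D + tail H) + A near
      ≡⟨ arith D (tail H) (A near) ⟩
    2 * D + (A near + tail H) ∎
    where
    open ≤-Reasoning
    D = A (λ x y → 𝟙 (y + k ≤? x))
    arith : ∀ d t n → d + (d + t) + n ≡ 2 * d + (n + t)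
    arith = solve-∀
    cover : ∀ x y → 1 ≤ 𝟙 (y + k ≤? x) + 𝟙 (x + k ≤? y) + near x y
    cover x y with y + k ≤? x | x + k ≤? y
    ... | yes _ | _     = s≤s z≤n
    ... | no _  | yes _ = s≤s z≤n
    ... | no p  | no q  = ≤-reflexive (sym (𝟙-yes ((x <? y + k) ×-dec (y <? x + k)) (≰⇒> p , ≰⇒> q)))

  near-count : ∀ x → Σ< Y (near x) ≤ 2 * k
  near-count x = ≤-trans (Σ-mono Y (λ y _ → 𝟙-mono ((x <? y + k) ×-dec (y <? x + k))
      -- Truncated subtraction starts the interval at 0 when x < k; its length 2k still suffices.
      ((x ∸ k ≤? y) ×-dec (y <? (x ∸ k) + 2 * k)) (λ (p , q) →
        m≤n+o⇒m∸n≤o x k (≤-trans (<⇒≤ p) (≤-reflexive (+-comm y k))) ,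
        <-≤-trans q (bound x))))
    (Σ-𝟙-interval Y (x ∸ k) (2 * k))
    where
    bound : ∀ x → x + k ≤ (x ∸ k) + 2 * k
    bound x = ≤-trans (+-monoˡ-≤ k (≤-trans (m≤n+m∸n x k) (≤-reflexive (+-comm k (x ∸ k)))))
      (≤-reflexive (trans (+-assoc (x ∸ k) k k) (cong (λ t → x ∸ k + (k + t)) (sym (+-identityʳ k)))))

  -- Fix x < H. By `V-halving` the weight at a near y is at most twice that at each of y, ..., y +
  -- r. All of these lie in the row of x by the first hypothesis, and the second keeps M units for
  -- the other entries. So r + 1 times the weight of one cell is at most twice the row, and a row
  -- has at most 2k near cells. Rows with x ≥ H go to the tail.
  near-bound : ∀ H r M → H + k + r ≤ Y → H + H + k + r + M ≤ m → 2 * r * length bs ≤ M → 0 < M →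
    suc r * A near ≤ 4 * k * total + suc r * tail H
  near-bound H r M le₁ le₂ rN≤M 0<M = begin
    suc r * A near
      ≡⟨ Σ-* (Y + k) (suc r) _ ⟨
    Σ< (Y + k) (λ x → suc r * Σ< Y (λ y → near x y * v (x + y)))
      ≤⟨ Σ-mono (Y + k) (λ x _ → row x) ⟩
    Σ< (Y + k) (λ x → 4 * k * R x + suc r * Σ< Y (λ y → 𝟙 (H ≤? x) * v (x + y)))
      ≡⟨ Σ-+ (Y + k) _ _ ⟩
    Σ< (Y + k) (λ x → 4 * k * R x) + Σ< (Y + k) (λ x → suc r * Σ< Y (λ y → 𝟙 (H ≤? x) * v (x + y)))
      ≡⟨ cong₂ _+_ (Σ-* (Y + k) (4 * k) R) (Σ-* (Y + k) (suc r) _) ⟩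
    4 * k * total + suc r * tail H ∎
    where
    open ≤-Reasoning
    R : ℕ → ℕ
    R x = Σ< Y (λ y → 1 * v (x + y))
    cell : ∀ x y → x < H → y < x + k → suc r * v (x + y) ≤ 2 * R x
    cell x y x<H y<x+k = begin
      suc r * v (x + y)                        ≡⟨ Σ-const (suc r) (v (x + y)) ⟨
      Σ< (suc r) (λ _ → v (x + y))
        ≤⟨ Σ-mono (suc r) (λ i i<1+r → V-halving bs m (x + y) M r i (s≤s⁻¹ i<1+r)
             fits rN≤M 0<M) ⟩
      Σ< (suc r) (λ i → 2 * v (x + y + i))
        ≡⟨ Σ-* (suc r) 2 (λ i → v (x + y + i)) ⟩
      2 * Σ< (suc r) (λ i → v (x + y + i))
        ≡⟨ cong (2 *_) (Σ-cong (suc r) (λ i → trans (cong v (+-assoc x y i)) (sym (*-identityˡ _)))) ⟩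
      2 * Σ< (suc r) (λ i → 1 * v (x + (y + i)))
        ≤⟨ *-monoʳ-≤ 2 (Σ-window {y} {suc r} inY (λ y → 1 * v (x + y))) ⟩
      2 * R x ∎
      where
      inY : y + suc r ≤ Y
      inY = linear 1 (+-mono-≤ (+-mono-≤ x<H y<x+k) le₁) (arith x y k r H Y)
        where
        arith : ∀ x y k r H Y → y + suc r + (H + (x + k) + Y) + 1 ≡ Y + (suc x + suc y + (H + k + r))
        arith = solve-∀
      fits : x + y + r + M ≤ m
      fits = linear 3 (+-mono-≤ (+-mono-≤ (+-mono-≤ x<H x<H) y<x+k) le₂) (arith x y k r H M m)
        where
        arith : ∀ x y k r H M m → x + y + r + M + (H + H + (x + k) + m) + 3
          ≡ m + (suc x + suc x + suc y + (H + H + k + r + M))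
        arith = solve-∀
    row : ∀ x → suc r * Σ< Y (λ y → near x y * v (x + y))
      ≤ 4 * k * R x + suc r * Σ< Y (λ y → 𝟙 (H ≤? x) * v (x + y))
    row x with H ≤? x
    ... | yes _  = ≤-trans (*-monoʳ-≤ (suc r) (Σ-mono Y (λ y _ → *-monoˡ-≤ (v (x + y))
                     (𝟙≤1 ((x <? y + k) ×-dec (y <? x + k)))))) (m≤n+m _ (4 * k * R x))
    ... | no H≰x = ≤-trans (begin
      suc r * Σ< Y (λ y → near x y * v (x + y)) ≡⟨ Σ-* Y (suc r) _ ⟨
      Σ< Y (λ y → suc r * (near x y * v (x + y)))
        ≡⟨ Σ-cong Y (λ y → *-swap (suc r) (near x y) _) ⟩
      Σ< Y (λ y → near x y * (suc r * v (x + y)))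
        ≤⟨ Σ-mono Y (λ y _ → 𝟙*-mono ((x <? y + k) ×-dec (y <? x + k)) (λ p → cell x y (≰⇒> H≰x) (proj₂ p))) ⟩
      Σ< Y (λ y → near x y * (2 * R x))
        ≡⟨ trans (Σ-cong Y (λ y → *-comm (near x y) _)) (Σ-* Y (2 * R x) (near x)) ⟩
      2 * R x * Σ< Y (near x)
        ≤⟨ *-monoʳ-≤ (2 * R x) (near-count x) ⟩
      2 * R x * (2 * k)
        ≡⟨ four (R x) k ⟩
      4 * k * R x ∎) (m≤m+n _ _)
      where
      four : ∀ a b → 2 * a * (2 * b) ≡ 4 * b * a
      four = solve-∀

-- Lehmer codes

Code : ℕ → Set
Code zero    = ⊤
Code (suc n) = Fin (suc n) × Code n

codes : ∀ n → List (Code n)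
codes zero    = tt ∷ []
codes (suc n) = cartesianProduct (allFin (suc n)) (codes n)

coord : ∀ {n} → Code n → ℕ → ℕ
coord {zero}  _       _       = 0
coord {suc n} (a , _) zero    = toℕ a
coord {suc n} (_ , c) (suc p) = coord c p

tot : ∀ {n} → Code n → ℕ
tot {zero}  _       = 0
tot {suc n} (a , c) = toℕ a + tot c

-- The head of the code is the first value itself. `punchIn a` relabels the later values
-- increasingly so as to avoid a, so a counts the later values below the first.
decode : ∀ {n} → Code n → Vec (Fin n) n
decode {zero}  _       = []
decode {suc n} (a , c) = a ∷ Vec.map (punchIn a) (decode c)

punchIn-low : ∀ {n} (b : Fin (suc n)) (t : Fin n) → toℕ t < toℕ b → toℕ (punchIn b t) ≡ toℕ t
punchIn-low (suc b) zero    _       = refl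
punchIn-low (suc b) (suc t) (s≤s p) = cong suc (punchIn-low b t p)

punchIn-high : ∀ {n} (b : Fin (suc n)) (t : Fin n) → toℕ b ≤ toℕ t → toℕ (punchIn b t) ≡ suc (toℕ t)
punchIn-high zero    t       _       = refl
punchIn-high (suc b) (suc t) (s≤s p) = cong suc (punchIn-high b t p)

punchIn-≥ : ∀ {n} (b : Fin (suc n)) (t : Fin n) → toℕ t ≤ toℕ (punchIn b t)
punchIn-≥ b t with toℕ t <? toℕ b
... | yes p = ≤-reflexive (sym (punchIn-low b t p))
... | no  p = ≤-trans (n≤1+n _) (≤-reflexive (sym (punchIn-high b t (≮⇒≥ p))))

punchIn-≤ : ∀ {n} (b : Fin (suc n)) (t : Fin n) → toℕ (punchIn b t) ≤ suc (toℕ t)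
punchIn-≤ b t with toℕ t <? toℕ b
... | yes p = ≤-trans (≤-reflexive (punchIn-low b t p)) (n≤1+n _)
... | no  p = ≤-reflexive (punchIn-high b t (≮⇒≥ p))

punchIn-cancel-< : ∀ {n} (b : Fin (suc n)) (t u : Fin n) → punchIn b t Fin.< punchIn b u → t Fin.< u
punchIn-cancel-< b t u p = ≰⇒> (λ u≤t → <⇒≱ p (FinP.punchIn-mono-≤ b u t u≤t))

punchIn-mono-< : ∀ {n} (b : Fin (suc n)) (t u : Fin n) → t Fin.< u → punchIn b t Fin.< punchIn b u
punchIn-mono-< b t u p = ≰⇒> (λ q → <⇒≱ p (FinP.punchIn-cancel-≤ b u t q))

ΣF : ∀ n → (Fin n → ℕ) → ℕ
ΣF n f = sum (tabulate f)

ΣF-cong : ∀ n {f g : Fin n → ℕ} → (∀ i → f i ≡ g i) → ΣF n f ≡ ΣF n g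
ΣF-cong n e = cong sum (ListP.tabulate-cong e)

ΣF-toℕ : ∀ n (f : ℕ → ℕ) → ΣF n (f ∘ toℕ) ≡ Σ< n f
ΣF-toℕ zero    f = refl
ΣF-toℕ (suc n) f = cong (f 0 +_) (ΣF-toℕ n (f ∘ suc))

sum-allFin : ∀ n (f : Fin n → ℕ) → sum (map f (allFin n)) ≡ ΣF n f
sum-allFin n f = cong sum (ListP.map-tabulate id f)

length-filter : ∀ {A : Set} {P : A → Set} (P? : ∀ x → Dec (P x)) xs →
  length (filter P? xs) ≡ sum (map (𝟙 ∘ P?) xs)
length-filter P? []       = refl
length-filter P? (x ∷ xs) with P? x
... | yes _ = cong suc (length-filter P? xs)
... | no  _ = length-filter P? xs

sum-map-cong : ∀ {A : Set} {f g : A → ℕ} → (∀ x → f x ≡ g x) → ∀ xs → sum (map f xs) ≡ sum (map g xs)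
sum-map-cong e xs = cong sum (ListP.map-cong e xs)

inversion? : ∀ {n} (σ : Vec (Fin n) n) (i j : Fin n) → Dec (i Fin.< j × lookup σ j Fin.< lookup σ i)
inversion? σ i j = (i Fin.<? j) ×-dec (lookup σ j Fin.<? lookup σ i)

inv-Σ : ∀ {n} (σ : Vec (Fin n) n) → inv σ ≡ ΣF n (λ i → ΣF n (λ j → 𝟙 (inversion? σ i j)))
inv-Σ {n} σ = trans (sum-allFin n _) (ΣF-cong n (λ i →
  trans (length-filter (inversion? σ i) (allFin n)) (sum-allFin n _)))

-- Bijectivity of the decoded word, in the form needed to count inversions. Removing the first value
-- b lowers a threshold above b by one, the first position accounting for the difference; a
-- threshold at most b is unaffected by the relabelling.
count-below : ∀ {n} (c : Code n) a → a ≤ n → ΣF n (λ j → 𝟙 (toℕ (lookup (decode c) j) <? a)) ≡ a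
count-below {zero}  _       zero    _   = refl
count-below {suc n} (b , c) a a≤n with toℕ b <? a
count-below {suc n} (b , c) (suc a) (s≤s a≤n) | yes (s≤s b≤a) = cong suc (trans
  (ΣF-cong n (λ j → 𝟙-cong (toℕ (lookup (Vec.map (punchIn b) (decode c)) j) <? suc a)
    (toℕ (lookup (decode c) j) <? a) (to j) (from j)))
  (count-below c a a≤n))
  where
  to : ∀ j → toℕ (lookup (Vec.map (punchIn b) (decode c)) j) < suc a → toℕ (lookup (decode c) j) < a
  to j p rewrite VecP.lookup-map j (punchIn b) (decode c) with toℕ (lookup (decode c) j) <? toℕ b
  ... | yes q = <-≤-trans q b≤a
  ... | no  q rewrite punchIn-high b (lookup (decode c) j) (≮⇒≥ q) = s<s⁻¹ p
  from : ∀ j → toℕ (lookup (decode c) j) < a → toℕ (lookup (Vec.map (punchIn b) (decode c)) j) < suc a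
  from j p rewrite VecP.lookup-map j (punchIn b) (decode c) =
    s≤s (≤-trans (punchIn-≤ b (lookup (decode c) j)) p)
... | no b≮a = trans
  (ΣF-cong n (λ j → 𝟙-cong (toℕ (lookup (Vec.map (punchIn b) (decode c)) j) <? a)
    (toℕ (lookup (decode c) j) <? a) (to j) (from j)))
  (count-below c a (≤-trans (≮⇒≥ b≮a) (FinP.toℕ≤pred[n] b)))
  where
  to : ∀ j → toℕ (lookup (Vec.map (punchIn b) (decode c)) j) < a → toℕ (lookup (decode c) j) < a
  to j p rewrite VecP.lookup-map j (punchIn b) (decode c) = ≤-<-trans (punchIn-≥ b (lookup (decode c) j)) p
  from : ∀ j → toℕ (lookup (decode c) j) < a → toℕ (lookup (Vec.map (punchIn b) (decode c)) j) < a
  from j p rewrite VecP.lookup-map j (punchIn b) (decode c)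
    | punchIn-low b (lookup (decode c) j) (<-≤-trans p (≮⇒≥ b≮a)) = p

-- By `count-below` the first position starts exactly a inversions. The others are those of the
-- tail, since `punchIn a` is strictly increasing.
inv-decode : ∀ {n} (c : Code n) → inv (decode c) ≡ tot c
inv-decode {zero}  _       = refl
inv-decode {suc n} (a , c) = trans (inv-Σ (decode (a , c))) (cong₂ _+_ first
  (trans (ΣF-cong n rest) (trans (sym (inv-Σ (decode c))) (inv-decode c))))
  where
  σ = decode (a , c)
  first : ΣF (suc n) (λ j → 𝟙 (inversion? σ zero j)) ≡ toℕ a
  first = cong₂ _+_ (𝟙-no (inversion? σ zero zero) (λ ())) (trans
    (ΣF-cong n (λ j → 𝟙-cong (inversion? σ zero (suc j)) (toℕ (lookup (decode c) j) <? toℕ a) (to j) (from j)))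
    (count-below c (toℕ a) (FinP.toℕ≤pred[n] a)))
    where
    to : ∀ j → zero {n} Fin.< suc j × lookup σ (suc j) Fin.< a → toℕ (lookup (decode c) j) < toℕ a
    to j (_ , p) rewrite VecP.lookup-map j (punchIn a) (decode c) = ≤-<-trans (punchIn-≥ a (lookup (decode c) j)) p
    from : ∀ j → toℕ (lookup (decode c) j) < toℕ a → zero {n} Fin.< suc j × lookup σ (suc j) Fin.< a
    from j p rewrite VecP.lookup-map j (punchIn a) (decode c)
      | punchIn-low a (lookup (decode c) j) p = z<s , p
  rest : ∀ i → ΣF (suc n) (λ j → 𝟙 (inversion? σ (suc i) j)) ≡ ΣF n (λ j → 𝟙 (inversion? (decode c) i j))
  rest i = cong₂ _+_ (𝟙-no (inversion? σ (suc i) zero) (λ ()))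
    (ΣF-cong n (λ j → 𝟙-cong (inversion? σ (suc i) (suc j)) (inversion? (decode c) i j) (to j) (from j)))
    where
    to : ∀ j → suc i Fin.< suc j × lookup σ (suc j) Fin.< lookup σ (suc i) →
      i Fin.< j × lookup (decode c) j Fin.< lookup (decode c) i
    to j (p , q) rewrite VecP.lookup-map j (punchIn a) (decode c) | VecP.lookup-map i (punchIn a) (decode c) =
      s<s⁻¹ p , punchIn-cancel-< a _ _ q
    from : ∀ j → i Fin.< j × lookup (decode c) j Fin.< lookup (decode c) i →
      suc i Fin.< suc j × lookup σ (suc j) Fin.< lookup σ (suc i)
    from j (p , q) rewrite VecP.lookup-map j (punchIn a) (decode c) | VecP.lookup-map i (punchIn a) (decode c) =
      s<s p , punchIn-mono-< a _ _ q

-- Permutations are exactly the decoded codes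

concatMap-map : ∀ {A B C : Set} (f : A → B → C) xs ys →
  concatMap (λ x → map (f x) ys) xs ≡ cartesianProductWith f xs ys
concatMap-map f []       ys = refl
concatMap-map f (x ∷ xs) ys = cong (map (f x) ys ++_) (concatMap-map f xs ys)

words-unique : ∀ n k → Unique (words n k)
words-unique n zero    = [] ∷ []
words-unique n (suc k) = subst Unique (sym (concatMap-map _∷_ (allFin n) (words n k)))
  (UniqueP.cartesianProductWith⁺ _∷_ VecP.∷-injective (UniqueP.allFin⁺ n) (words-unique n k))

words-complete : ∀ n {k} (v : Vec (Fin n) k) → v ∈ words n k
words-complete n []      = here refl
words-complete n {suc k} (x ∷ v) = subst ((x ∷ v) ∈_) (sym (concatMap-map _∷_ (allFin n) (words n k)))
  (∈-cartesianProductWith⁺ _∷_ (∈-allFin x) (words-complete n v))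

codes-unique : ∀ n → Unique (codes n)
codes-unique zero    = [] ∷ []
codes-unique (suc n) = UniqueP.cartesianProduct⁺ (UniqueP.allFin⁺ (suc n)) (codes-unique n)

codes-complete : ∀ {n} (c : Code n) → c ∈ codes n
codes-complete {zero}  tt      = here refl
codes-complete {suc n} (a , c) = ∈-cartesianProduct⁺ (∈-allFin a) (codes-complete c)

decode-injective : ∀ {n} {c d : Code n} → decode c ≡ decode d → c ≡ d
decode-injective {zero}          _ = refl
decode-injective {suc n} {a , c} {b , d} e with refl , e′ ← VecP.∷-injective e =
  cong (a ,_) (decode-injective (map-punchIn-injective (decode c) (decode d) e′))
  where
  map-punchIn-injective : ∀ {k} (v w : Vec (Fin n) k) → Vec.map (punchIn a) v ≡ Vec.map (punchIn a) w → v ≡ w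
  map-punchIn-injective []      []      _ = refl
  map-punchIn-injective (x ∷ v) (y ∷ w) e with p , q ← VecP.∷-injective e =
    cong₂ _∷_ (FinP.punchIn-injective a x y p) (map-punchIn-injective v w q)

decode-isPerm : ∀ {n} (c : Code n) → IsPerm (decode c)
decode-isPerm {zero}  _       = []
decode-isPerm {suc n} (a , c) rewrite VecP.toList-map (punchIn a) (decode c) =
  AllP.map⁺ (All.universal (λ t e → FinP.punchInᵢ≢i a t (sym e)) (toList (decode c))) ∷
  AllPairsP.map⁺ (AllPairs.map (λ x≢y e → x≢y (FinP.punchIn-injective a _ _ e)) (decode-isPerm c))

-- Inverts the relabelling in `decode`: avoiding a means lying in the image of the injection
-- `punchIn a`. This is the induction step of `encode`.
unpunch : ∀ {n k} (a : Fin (suc n)) (w : Vec (Fin (suc n)) k) → All (a ≢_) (toList w) → AllPairs _≢_ (toList w) →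
  ∃[ u ] (w ≡ Vec.map (punchIn a) u × AllPairs _≢_ (toList u))
unpunch a []      []         []         = [] , refl , []
unpunch a (x ∷ w) (a≢x ∷ a≢w) (x≢w ∷ w≢) with u , refl , u≢ ← unpunch a w a≢w w≢ =
  punchOut a≢x ∷ u , cong (_∷ _) (sym (FinP.punchIn-punchOut a≢x)) ,
  All.map (λ {t} x≢ e → x≢ (trans (sym (FinP.punchIn-punchOut a≢x)) (cong (punchIn a) e)))
    (AllP.map⁻ (subst (All (x ≢_)) (VecP.toList-map (punchIn a) u) x≢w)) ∷ u≢

encode : ∀ {n} (v : Vec (Fin n) n) → IsPerm v → ∃[ c ] v ≡ decode c
encode {zero}  []      _        = tt , refl
encode {suc n} (a ∷ w) (p ∷ q) with u , refl , u≢ ← unpunch a w p q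
  with c , refl ← encode u u≢ = (a , c) , refl

isPerm? : ∀ {n} (v : Vec (Fin n) n) → Dec (IsPerm v)
isPerm? v = allPairs? (λ x y → ¬? (x Fin.≟ y)) (toList v)

-- Both lists are free of repetitions and have the same members, so sums over permutations become
-- sums over codes.
perms-decode : ∀ n → perms n ↭ map decode (codes n)
perms-decode n = ∼bag⇒↭ (unique∧set⇒bag
  (UniqueP.filter⁺ isPerm? (words-unique n n))
  (UniqueP.map⁺ decode-injective (codes-unique n))
  (mk⇔ to from))
  where
  to : ∀ {v} → v ∈ perms n → v ∈ map decode (codes n)
  to {v} v∈ with c , refl ← encode v (proj₂ (∈-filter⁻ isPerm? {xs = words n n} v∈)) =
    ∈-map⁺ decode (codes-complete c)
  from : ∀ {v} → v ∈ map decode (codes n) → v ∈ perms n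
  from v∈ with c , _ , refl ← ∈-map⁻ decode v∈ =
    ∈-filter⁺ isPerm? (words-complete n (decode c)) (decode-isPerm c)

-- Sums over codes with one or two entries singled out

ΣC : ∀ n → (Code n → ℕ) → ℕ
ΣC n F = sum (map F (codes n))

Σ-perms : ∀ n (F : Vec (Fin n) n → ℕ) → sum (map F (perms n)) ≡ ΣC n (F ∘ decode)
Σ-perms n F = trans (sum-↭ (Perm.map⁺ F (perms-decode n)))
  (cong sum (sym (ListP.map-∘ (codes n))))

sum-cartesianProduct : ∀ {A B : Set} (F : A × B → ℕ) xs ys →
  sum (map F (cartesianProduct xs ys)) ≡ sum (map (λ x → sum (map (λ y → F (x , y)) ys)) xs)
sum-cartesianProduct F []       ys = refl
sum-cartesianProduct F (x ∷ xs) ys = trans (cong sum (ListP.map-++ F (map (x ,_) ys) _))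
  (trans (sum-++ (map F (map (x ,_) ys)) _)
    (cong₂ _+_ (cong sum (sym (ListP.map-∘ ys))) (sum-cartesianProduct F xs ys)))

ΣC-suc : ∀ n (F : Code (suc n) → ℕ) (f : ℕ → ℕ) → (∀ a → ΣC n (λ c → F (a , c)) ≡ f (toℕ a)) →
  ΣC (suc n) F ≡ Σ< (suc n) f
ΣC-suc n F f e = trans (sum-cartesianProduct F (allFin (suc n)) (codes n))
  (trans (sum-allFin (suc n) _) (trans (ΣF-cong (suc n) e) (ΣF-toℕ (suc n) f)))

sizes : ℕ → List ℕ
sizes zero    = []
sizes (suc n) = suc n ∷ sizes n

-- With n = p + suc q, these are the sizes left when position p, of size `suc q`, is removed.
-- `others₂` also removes position p + suc l, where n = p + suc (l + suc q). Writing n in this way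
-- allows recursion on p.
others : ℕ → ℕ → List ℕ
others zero    q = sizes q
others (suc p) q = suc (p + suc q) ∷ others p q

others₂ : ℕ → ℕ → ℕ → List ℕ
others₂ zero    l q = others l q
others₂ (suc p) l q = suc (p + suc (l + suc q)) ∷ others₂ p l q

ΣC-tot : ∀ n (F : ℕ → ℕ) → ΣC n (F ∘ tot) ≡ G (sizes n) F
ΣC-tot zero    F = +-identityʳ (F 0)
ΣC-tot (suc n) F = ΣC-suc n (F ∘ tot) (λ a → G (sizes n) (λ s → F (a + s))) (λ a → ΣC-tot n (λ s → F (toℕ a + s)))

-- The sum over the chosen entry is pulled outwards past one earlier entry at a time.
ΣC-coord : ∀ p q (F : ℕ → ℕ → ℕ) →
  ΣC (p + suc q) (λ c → F (coord c p) (tot c)) ≡ Σ< (suc q) (λ x → G (others p q) (λ s → F x (x + s)))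
ΣC-coord zero    q F = ΣC-suc q _ (λ x → G (sizes q) (λ s → F x (x + s)))
  (λ a → ΣC-tot q (λ s → F (toℕ a) (toℕ a + s)))
ΣC-coord (suc p) q F = trans
  (ΣC-suc n _ (λ a → Σ< (suc q) (f a)) (λ a → ΣC-coord p q (λ x s → F x (toℕ a + s))))
  (trans (Σ-swap (suc n) (suc q) f)
    (Σ-cong (suc q) (λ x → Σ-cong (suc n) (λ a → G-cong (others p q) (λ s → cong (F x) (+-swap a x s))))))
  where
  n = p + suc q
  f : ℕ → ℕ → ℕ
  f a x = G (others p q) (λ s → F x (a + (x + s)))

ΣC-coords : ∀ p l q (F : ℕ → ℕ → ℕ → ℕ) →
  ΣC (p + suc (l + suc q)) (λ c → F (coord c p) (coord c (p + suc l)) (tot c)) ≡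
  Σ< (suc (l + suc q)) (λ x → Σ< (suc q) (λ y → G (others₂ p l q) (λ s → F x y (x + y + s))))
ΣC-coords zero    l q F = ΣC-suc (l + suc q) _
  (λ x → Σ< (suc q) (λ y → G (others l q) (λ s → F x y (x + y + s)))) (λ a →
  trans (ΣC-coord l q (λ y s → F (toℕ a) y (toℕ a + s)))
    (Σ-cong (suc q) (λ y → G-cong (others l q) (λ s → cong (F (toℕ a) y) (sym (+-assoc (toℕ a) y s))))))
ΣC-coords (suc p) l q F = trans
  (ΣC-suc n _ (λ a → Σ< (suc (l + suc q)) (λ x → Σ< (suc q) (f a x)))
    (λ a → ΣC-coords p l q (λ x y s → F x y (toℕ a + s))))
  (trans (Σ-swap (suc n) (suc (l + suc q)) (λ a x → Σ< (suc q) (f a x)))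
    (Σ-cong (suc (l + suc q)) (λ x → trans (Σ-swap (suc n) (suc q) (λ a → f a x))
      (Σ-cong (suc q) (λ y → Σ-cong (suc n) (λ a →
        G-cong (others₂ p l q) (λ s → cong (F x y) (+-swap a (x + y) s))))))))
  where
  n = p + suc (l + suc q)
  f : ℕ → ℕ → ℕ → ℕ
  f a x y = G (others₂ p l q) (λ s → F x y (a + (x + y + s)))

-- Values of a permutation against its code

lookup-≥ : ∀ {n} (c : Code n) i → coord c (toℕ i) ≤ toℕ (lookup (decode c) i)
lookup-≥ {suc n} (a , c) zero    = ≤-refl
lookup-≥ {suc n} (a , c) (suc i) rewrite VecP.lookup-map i (punchIn a) (decode c) =
  ≤-trans (lookup-≥ c i) (punchIn-≥ a _)

-- The value at i starts as its code entry and is relabelled once for each of the `toℕ i` earlier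
-- positions, rising by 0 or 1 each time.
lookup-≤ : ∀ {n} (c : Code n) i → toℕ (lookup (decode c) i) ≤ coord c (toℕ i) + toℕ i
lookup-≤ {suc n} (a , c) zero    = m≤m+n _ 0
lookup-≤ {suc n} (a , c) (suc i) rewrite VecP.lookup-map i (punchIn a) (decode c) =
  ≤-trans (punchIn-≤ a _) (≤-trans (s≤s (lookup-≤ c i)) (≤-reflexive (sym (+-suc _ (toℕ i)))))

-- The relabellings due to positions before i preserve order, so i may be taken first. Then its
-- value is its code entry, while the value at j is at least its own.
lookup-<⇒coord-< : ∀ {n} (c : Code n) (i j : Fin n) → i Fin.< j →
  lookup (decode c) j Fin.< lookup (decode c) i → coord c (toℕ j) < coord c (toℕ i)
lookup-<⇒coord-< {suc n} (a , c) zero    (suc j) _ p rewrite VecP.lookup-map j (punchIn a) (decode c) =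
  ≤-<-trans (≤-trans (lookup-≥ c j) (punchIn-≥ a _)) p
lookup-<⇒coord-< {suc n} (a , c) (suc i) (suc j) i<j p
  rewrite VecP.lookup-map j (punchIn a) (decode c) | VecP.lookup-map i (punchIn a) (decode c) =
  lookup-<⇒coord-< c i j (s<s⁻¹ i<j) (punchIn-cancel-< a _ _ p)

-- Again i may be taken first, with value a. Before the relabelling by a, the value at j is at most
-- its code entry plus k, hence below a, so `punchIn a` leaves it fixed.
coord-gap⇒lookup-< : ∀ {n} (c : Code n) (i j : Fin n) k → toℕ i + suc k ≡ toℕ j →
  coord c (toℕ j) + suc k ≤ coord c (toℕ i) → lookup (decode c) j Fin.< lookup (decode c) i
coord-gap⇒lookup-< {suc n} (a , c) zero    (suc j) k refl p
  rewrite VecP.lookup-map j (punchIn a) (decode c) =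
  subst (_< toℕ a) (sym (punchIn-low a _ t<a)) t<a
  where
  t<a : toℕ (lookup (decode c) j) < toℕ a
  t<a = ≤-trans (s≤s (lookup-≤ c j)) (≤-trans (≤-reflexive (sym (+-suc _ (toℕ j)))) p)
coord-gap⇒lookup-< {suc n} (a , c) (suc i) (suc j) k e p
  rewrite VecP.lookup-map j (punchIn a) (decode c) | VecP.lookup-map i (punchIn a) (decode c) =
  punchIn-mono-< a _ _ (coord-gap⇒lookup-< c i j k (suc-injective e) p)

-- Counting permutations with a given number of inversions

count : ∀ n m → (Vec (Fin n) n → ℕ) → ℕ
count n m F = sum (map (λ σ → δ m (inv σ) * F σ) (perms n))

sum-filter : ∀ {A : Set} {P : A → Set} (P? : ∀ x → Dec (P x)) (F : A → ℕ) xs →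
  sum (map F (filter P? xs)) ≡ sum (map (λ x → 𝟙 (P? x) * F x) xs)
sum-filter P? F []       = refl
sum-filter P? F (x ∷ xs) with P? x
... | yes _ = cong₂ _+_ (sym (*-identityˡ (F x))) (sum-filter P? F xs)
... | no  _ = sum-filter P? F xs

length-filter-permsInv : ∀ n m {P : Vec (Fin n) n → Set} (P? : ∀ σ → Dec (P σ)) →
  length (filter P? (permsInv n m)) ≡ count n m (𝟙 ∘ P?)
length-filter-permsInv n m P? = trans (length-filter P? (permsInv n m))
  (sum-filter (λ σ → inv σ ≟ m) (𝟙 ∘ P?) (perms n))

length-permsInv : ∀ n m → length (permsInv n m) ≡ count n m (λ _ → 1)
length-permsInv n m = trans (length-filter (λ σ → inv σ ≟ m) (perms n))
  (sum-map-cong (λ σ → sym (*-identityʳ (δ m (inv σ)))) (perms n))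

count-decode : ∀ n m F → count n m F ≡ ΣC n (λ c → δ m (tot c) * F (decode c))
count-decode n m F = trans (Σ-perms n _)
  (sum-map-cong (λ c → cong (λ t → δ m t * F (decode c)) (inv-decode c)) (codes n))

sum-map-mono : ∀ {A : Set} {f g : A → ℕ} → (∀ x → f x ≤ g x) → ∀ xs → sum (map f xs) ≤ sum (map g xs)
sum-map-mono e []       = z≤n
sum-map-mono e (x ∷ xs) = +-mono-≤ (e x) (sum-map-mono e xs)

sum-map-+ : ∀ {A : Set} (f g : A → ℕ) xs → sum (map (λ x → f x + g x) xs) ≡ sum (map f xs) + sum (map g xs)
sum-map-+ f g []       = refl
sum-map-+ f g (x ∷ xs) = trans (cong (f x + g x +_) (sum-map-+ f g xs)) (+-interchange (f x) (g x) _ _)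

count-mono : ∀ n m {F F′} → (∀ σ → F σ ≤ F′ σ) → count n m F ≤ count n m F′
count-mono n m le = sum-map-mono (λ σ → *-monoʳ-≤ (δ m (inv σ)) (le σ)) (perms n)

count-+ : ∀ n m F F′ → count n m (λ σ → F σ + F′ σ) ≡ count n m F + count n m F′
count-+ n m F F′ = trans (sum-map-cong (λ σ → *-distribˡ-+ (δ m (inv σ)) (F σ) (F′ σ)) (perms n))
  (sum-map-+ _ _ (perms n))

codeCount : ∀ n m → (Code n → ℕ) → ℕ
codeCount n m g = ΣC n (λ c → δ m (tot c) * g c)

codeCount-mono : ∀ n m {g g′} → (∀ c → g c ≤ g′ c) → codeCount n m g ≤ codeCount n m g′
codeCount-mono n m le = sum-map-mono (λ c → *-monoʳ-≤ (δ m (tot c)) (le c)) (codes n)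

G-δ-* : ∀ bs m z g → G bs (λ s → δ m (z + s) * g) ≡ g * V bs m z
G-δ-* bs m z g = trans (G-cong bs (λ s → *-comm (δ m (z + s)) g)) (G-* bs g _)

codeCount-coord : ∀ p q m (g : ℕ → ℕ) →
  codeCount (p + suc q) m (λ c → g (coord c p)) ≡ Σ< (suc q) (λ x → g x * V (others p q) m x)
codeCount-coord p q m g = trans (ΣC-coord p q (λ x s → δ m s * g x))
  (Σ-cong (suc q) (λ x → G-δ-* (others p q) m x (g x)))

codeCount-coords : ∀ p l q m (g : ℕ → ℕ → ℕ) →
  codeCount (p + suc (l + suc q)) m (λ c → g (coord c p) (coord c (p + suc l)))
  ≡ Joint.A (others₂ p l q) m (suc q) (suc l) g
codeCount-coords p l q m g = trans (ΣC-coords p l q (λ x y s → δ m s * g x y))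
  (trans (Σ-cong (suc (l + suc q)) (λ x → Σ-cong (suc q) (λ y → G-δ-* (others₂ p l q) m (x + y) (g x y))))
    (cong (λ b → Σ< b (λ x → Σ< (suc q) (λ y → g x y * V (others₂ p l q) m (x + y)))) (+-comm (suc l) (suc q))))

-- The sizes run from n down to 1, and at most 2h of them are below 2h. In `big-others` one more is
-- lost to the removed entry.
big-sizes : ∀ h n → n ≤ big h (sizes n) + 2 * h
big-sizes h zero    = z≤n
big-sizes h (suc n) with h + h ≤? suc n
... | yes _ = s≤s (big-sizes h n)
... | no ¬p = ≤-trans (<⇒≤ (≰⇒> ¬p)) (≤-trans (≤-reflexive (cong (h +_) (sym (+-identityʳ h)))) (m≤n+m (2 * h) (big h (sizes n))))

big-others : ∀ h p q → p + suc q ≤ suc (big h (others p q) + 2 * h)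
big-others h zero    q = s≤s (big-sizes h q)
big-others h (suc p) q with h + h ≤? suc (p + suc q)
... | yes _ = s≤s (big-others h p q)
... | no ¬p = ≤-trans (<⇒≤ (≰⇒> ¬p)) (≤-trans (≤-reflexive (cong (h +_) (sym (+-identityʳ h))))
                (≤-trans (m≤n+m (2 * h) (big h (others p q))) (n≤1+n (big h (others p q) + 2 * h))))

length-sizes : ∀ n → length (sizes n) ≡ n
length-sizes zero    = refl
length-sizes (suc n) = cong suc (length-sizes n)

length-others : ∀ p q → length (others p q) ≤ p + suc q
length-others zero    q = ≤-trans (≤-reflexive (length-sizes q)) (n≤1+n q)
length-others (suc p) q = s≤s (length-others p q)

length-others₂ : ∀ p l q → length (others₂ p l q) ≤ p + suc (l + suc q)
length-others₂ zero    l q = ≤-trans (length-others l q) (n≤1+n _)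
length-others₂ (suc p) l q = s≤s (length-others₂ p l q)

-- With `big-others` this is the estimate O(m / (n h)) for the probability of a code entry of at
-- least h, as long as n - 2h is of order n.
codeCount-tail : ∀ p q m h →
  h * big h (others p q) * codeCount (p + suc q) m (λ c → 𝟙 (h ≤? coord c p))
  ≤ 2 * m * count (p + suc q) m (λ _ → 1)
codeCount-tail p q m h = begin
  h * big h (others p q) * codeCount (p + suc q) m (λ c → 𝟙 (h ≤? coord c p))
    ≡⟨ cong (h * big h (others p q) *_) (codeCount-coord p q m (λ x → 𝟙 (h ≤? x))) ⟩
  h * big h (others p q) * Σ< (suc q) (λ x → 𝟙 (h ≤? x) * V (others p q) m x)
    ≤⟨ tail-bound (others p q) m h (suc q) ⟩
  2 * m * Σ< (suc q) (V (others p q) m)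
    ≡⟨ cong (2 * m *_) (sym (trans (codeCount-coord p q m (λ _ → 1))
         (Σ-cong (suc q) (λ x → *-identityˡ (V (others p q) m x))))) ⟩
  2 * m * codeCount (p + suc q) m (λ _ → 1)
    ≡⟨ cong (2 * m *_) (sym (count-decode (p + suc q) m (λ _ → 1))) ⟩
  2 * m * count (p + suc q) m (λ _ → 1) ∎
  where open ≤-Reasoning

descents : ∀ n m → Fin n → Fin n → ℕ
descents n m i j = count n m (λ σ → 𝟙 (lookup σ j Fin.<? lookup σ i))

-- The bounds behind the limit ½; tl counts the permutations whose code at i is at least
-- H, and nr those whose code entries at i and j differ by less than the gap.
descents-half : ∀ n m (i j : Fin n) l q → toℕ i + suc l ≡ toℕ j → toℕ j + suc q ≡ n →
  ∀ H r M → H + suc l + r ≤ suc q → H + H + suc l + r + M ≤ m → 2 * r * n ≤ M → 0 < M →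
  let T = count n m (λ _ → 1); D = descents n m i j in
  ∃[ tl ] ∃[ nr ] ∃[ B ] (2 * D ≤ T + tl × T ≤ 2 * D + (nr + tl) ×
    suc r * nr ≤ 4 * suc l * T + suc r * tl × H * B * tl ≤ 2 * m * T × n ≤ suc (B + 2 * H))
descents-half n m i j l q gap e H r M le₁ le₂ le₃ 0<M = go (toℕ i) refl
  (trans (sym (+-assoc (toℕ i) (suc l) (suc q))) (trans (cong (_+ suc q) gap) e))
  where
  T = count n m (λ _ → 1)
  D = descents n m i j
  -- With `toℕ i` generalised to p, the length can be matched as p + suc (l + suc q), the shape in
  -- which both positions are singled out.
  go : ∀ p → toℕ i ≡ p → p + suc (l + suc q) ≡ n →
    ∃[ tl ] ∃[ nr ] ∃[ B ] (2 * D ≤ T + tl × T ≤ 2 * D + (nr + tl) ×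
    suc r * nr ≤ 4 * suc l * T + suc r * tl × H * B * tl ≤ 2 * m * T × n ≤ suc (B + 2 * H))
  go p ep refl = J.tail H , J.A J.near , big H (others p (l + suc q)) ,
    ≤-trans (*-monoʳ-≤ 2 D≤) (≤-trans (J.upper H H≤Y) (≤-reflexive (cong (_+ J.tail H) (sym T≡)))) ,
    ≤-trans (≤-reflexive T≡) (≤-trans (J.lower H H≤Y) (+-monoˡ-≤ _ (*-monoʳ-≤ 2 ≤D))) ,
    ≤-trans (J.near-bound H r M le₁ le₂ (≤-trans (*-monoʳ-≤ (2 * r) (length-others₂ p l q)) le₃) 0<M)
      (≤-reflexive (cong (λ t → 4 * suc l * t + suc r * J.tail H) (sym T≡))) ,
    ≤-trans (≤-reflexive (cong (H * big H (others p (l + suc q)) *_) (sym tail≡)))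
      (codeCount-tail p (l + suc q) m H) ,
    big-others H p (l + suc q)
    where
    module J = Joint (others₂ p l q) m (suc q) (suc l)
    H≤Y : H ≤ suc q
    H≤Y = ≤-trans (m≤m+n H (suc l)) (≤-trans (m≤m+n (H + suc l) r) le₁)
    T≡ : T ≡ J.total
    T≡ = trans (count-decode n m (λ _ → 1)) (codeCount-coords p l q m (λ _ _ → 1))
    tail≡ : codeCount n m (λ c → 𝟙 (H ≤? coord c p)) ≡ J.tail H
    tail≡ = codeCount-coords p l q m (λ x _ → 𝟙 (H ≤? x))
    ej : toℕ j ≡ p + suc l
    ej = trans (sym gap) (cong (_+ suc l) ep)
    i<j : i Fin.< j
    i<j = subst₂ _<_ (sym ep) (sym ej) (m<m+n p z<s)
    -- The sandwich: a descent forces y < x, and y + suc l ≤ x forces a descent. `J.upper` and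
    -- `J.lower` treat the two outer events.
    D≤ : D ≤ J.A (λ x y → 𝟙 (y <? x))
    D≤ = ≤-trans (≤-reflexive (count-decode n m _)) (≤-trans
      (codeCount-mono n m (λ c → 𝟙-mono (lookup (decode c) j Fin.<? lookup (decode c) i)
        (coord c (p + suc l) <? coord c p)
        (λ d → subst₂ (λ a b → coord c a < coord c b) ej ep (lookup-<⇒coord-< c i j i<j d))))
      (≤-reflexive (codeCount-coords p l q m (λ x y → 𝟙 (y <? x)))))
    ≤D : J.A (λ x y → 𝟙 (y + suc l ≤? x)) ≤ D
    ≤D = ≤-trans (≤-reflexive (sym (codeCount-coords p l q m (λ x y → 𝟙 (y + suc l ≤? x))))) (≤-trans
      (codeCount-mono n m (λ c → 𝟙-mono (coord c (p + suc l) + suc l ≤? coord c p)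
        (lookup (decode c) j Fin.<? lookup (decode c) i)
        (λ d → coord-gap⇒lookup-< c i j l gap
          (subst₂ (λ a b → coord c a + suc l ≤ coord c b) (sym ej) (sym ep) d))))
      (≤-reflexive (sym (count-decode n m _))))

-- Reverse-complement

sum-involution : ∀ {A : Set} {xs : List A} (f : A → A) (F : A → ℕ) → Unique xs →
  (∀ {x} → x ∈ xs → f x ∈ xs) → (∀ x → f (f x) ≡ x) → sum (map (F ∘ f) xs) ≡ sum (map F xs)
sum-involution {xs = xs} f F uniq closed invol = trans (cong sum (ListP.map-∘ xs))
  (sum-↭ (Perm.map⁺ F (∼bag⇒↭ (unique∧set⇒bag
    (UniqueP.map⁺ (λ {x} {y} e → trans (sym (invol x)) (trans (cong f e) (invol y))) uniq) uniq
    (mk⇔ to (λ x∈ → subst (_∈ map f xs) (invol _) (∈-map⁺ f (closed x∈))))))))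
  where
  to : ∀ {x} → x ∈ map f xs → x ∈ xs
  to x∈ with y , y∈ , refl ← ∈-map⁻ f x∈ = closed y∈

opp : ∀ {n} → Fin n → Fin n
opp = Fin.opposite

opp-sum : ∀ {n} (i : Fin n) → toℕ (opp i) + suc (toℕ i) ≡ n
opp-sum {n} i = trans (cong (_+ suc (toℕ i)) (FinP.opposite-prop i)) (m∸n+n≡m (FinP.toℕ<n i))

opp-sum′ : ∀ {n} (j : Fin n) → toℕ j + suc (toℕ (opp j)) ≡ n
opp-sum′ j = trans (+-suc (toℕ j) (toℕ (opp j))) (trans (+-comm (suc (toℕ j)) (toℕ (opp j))) (opp-sum j))

opp-anti : ∀ {n} (i j : Fin n) → i Fin.< j → opp j Fin.< opp i
opp-anti i j i<j = ≰⇒> (λ oi≤oj → <⇒≱ (+-mono-≤-< oi≤oj (s<s i<j))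
  (≤-reflexive (trans (opp-sum j) (sym (opp-sum i)))))

opp-anti⁻ : ∀ {n} (i j : Fin n) → opp j Fin.< opp i → i Fin.< j
opp-anti⁻ i j p = subst₂ Fin._<_ (FinP.opposite-involutive i) (FinP.opposite-involutive j) (opp-anti (opp j) (opp i) p)

rc : ∀ {n} → Vec (Fin n) n → Vec (Fin n) n
rc σ = Vec.tabulate (λ i → opp (lookup σ (opp i)))

lookup-rc : ∀ {n} (σ : Vec (Fin n) n) i → lookup (rc σ) i ≡ opp (lookup σ (opp i))
lookup-rc σ i = VecP.lookup∘tabulate _ i

rc-involutive : ∀ {n} (σ : Vec (Fin n) n) → rc (rc σ) ≡ σ
rc-involutive σ = trans (VecP.tabulate-cong (λ i → trans (cong opp (lookup-rc σ (opp i)))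
    (trans (FinP.opposite-involutive _) (cong (lookup σ) (FinP.opposite-involutive i)))))
  (VecP.tabulate∘lookup σ)

lookup-distinct : ∀ {A : Set} {k} {x : A} (v : Vec A k) → All (x ≢_) (toList v) → ∀ j → x ≢ lookup v j
lookup-distinct (y ∷ v) (q ∷ _)  zero    = q
lookup-distinct (y ∷ v) (_ ∷ qs) (suc j) = lookup-distinct v qs j

lookup-injective : ∀ {A : Set} {k} (v : Vec A k) → AllPairs _≢_ (toList v) → ∀ i j → lookup v i ≡ lookup v j → i ≡ j
lookup-injective (x ∷ v) _       zero    zero    _ = refl
lookup-injective (x ∷ v) (p ∷ _) zero    (suc j) e = ⊥-elim (lookup-distinct v p j e)
lookup-injective (x ∷ v) (p ∷ _) (suc i) zero    e = ⊥-elim (lookup-distinct v p i (sym e))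
lookup-injective (x ∷ v) (_ ∷ p) (suc i) (suc j) e = cong suc (lookup-injective v p i j e)

toList-tabulate : ∀ {A : Set} {n} (f : Fin n → A) → toList (Vec.tabulate f) ≡ tabulate f
toList-tabulate {n = zero}  f = refl
toList-tabulate {n = suc n} f = cong (f zero ∷_) (toList-tabulate (f ∘ suc))

opp-injective : ∀ {n} {i j : Fin n} → opp i ≡ opp j → i ≡ j
opp-injective {i = i} {j} e = trans (sym (FinP.opposite-involutive i))
  (trans (cong opp e) (FinP.opposite-involutive j))

rc-isPerm : ∀ {n} (σ : Vec (Fin n) n) → IsPerm σ → IsPerm (rc σ)
rc-isPerm σ p = subst (AllPairs _≢_) (sym (toList-tabulate _))
  (UniqueP.tabulate⁺ (λ {i} {j} e → opp-injective (lookup-injective σ p (opp i) (opp j) (opp-injective e))))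

inv-pairs : ∀ {n} (σ : Vec (Fin n) n) →
  inv σ ≡ sum (map (λ (i , j) → 𝟙 (inversion? σ i j)) (cartesianProduct (allFin n) (allFin n)))
inv-pairs {n} σ = trans (sum-map-cong (λ i → length-filter (inversion? σ i) (allFin n)) (allFin n))
  (sym (sum-cartesianProduct (λ (i , j) → 𝟙 (inversion? σ i j)) (allFin n) (allFin n)))

-- The map (i, j) to (opp j, opp i) carries the inversions of one permutation onto those of the
-- other.
inv-rc : ∀ {n} (σ : Vec (Fin n) n) → inv (rc σ) ≡ inv σ
inv-rc {n} σ = trans (inv-pairs (rc σ)) (trans (sum-map-cong same pairs)
  (trans (sum-involution flip-opp (λ (i , j) → 𝟙 (inversion? σ i j))
    (UniqueP.cartesianProduct⁺ (UniqueP.allFin⁺ n) (UniqueP.allFin⁺ n))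
    (λ _ → ∈-cartesianProduct⁺ (∈-allFin _) (∈-allFin _))
    (λ (i , j) → cong₂ _,_ (FinP.opposite-involutive i) (FinP.opposite-involutive j)))
  (sym (inv-pairs σ))))
  where
  pairs = cartesianProduct (allFin n) (allFin n)
  flip-opp : Fin n × Fin n → Fin n × Fin n
  flip-opp (i , j) = opp j , opp i
  same : ∀ ij → 𝟙 (inversion? (rc σ) (proj₁ ij) (proj₂ ij)) ≡ 𝟙 (inversion? σ (opp (proj₂ ij)) (opp (proj₁ ij)))
  same (i , j) = 𝟙-cong (inversion? (rc σ) i j) (inversion? σ (opp j) (opp i))
    (λ (p , d) → opp-anti i j p , opp-anti⁻ _ _ (subst₂ Fin._<_ (lookup-rc σ j) (lookup-rc σ i) d))
    (λ (p , d) → opp-anti⁻ i j p , subst₂ Fin._<_ (sym (lookup-rc σ j)) (sym (lookup-rc σ i)) (opp-anti _ _ d))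

count-rc : ∀ n m F → count n m (F ∘ rc) ≡ count n m F
count-rc n m F = trans
  (sum-map-cong (λ σ → cong (λ t → δ m t * F (rc σ)) (sym (inv-rc σ))) (perms n))
  (sum-involution rc (λ σ → δ m (inv σ) * F σ) (UniqueP.filter⁺ isPerm? (words-unique n n)) closed rc-involutive)
  where
  closed : ∀ {σ} → σ ∈ perms n → rc σ ∈ perms n
  closed {σ} σ∈ = ∈-filter⁺ isPerm? (words-complete n (rc σ))
    (rc-isPerm σ (proj₂ (∈-filter⁻ isPerm? {xs = words n n} σ∈)))

-- Positions and values are both reversed, so a descent stays a descent, at the reflected pair. This
-- moves a pair from the right part of the permutation to the left.
descents-rc : ∀ n m (i j : Fin n) → descents n m i j ≡ descents n m (opp j) (opp i)
descents-rc n m i j = trans (sum-map-cong (λ σ → cong (δ m (inv σ) *_) (𝟙-cong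
    (lookup σ j Fin.<? lookup σ i) (lookup (rc σ) (opp i) Fin.<? lookup (rc σ) (opp j))
    (λ d → subst₂ Fin._<_ (sym (rc-opp σ i)) (sym (rc-opp σ j)) (opp-anti _ _ d))
    (λ d → opp-anti⁻ _ _ (subst₂ Fin._<_ (rc-opp σ i) (rc-opp σ j) d)))) (perms n))
  (count-rc n m (λ σ → 𝟙 (lookup σ (opp i) Fin.<? lookup σ (opp j))))
  where
  rc-opp : ∀ σ i → lookup (rc σ) (opp i) ≡ opp (lookup σ i)
  rc-opp σ i = trans (lookup-rc σ (opp i)) (cong (λ t → opp (lookup σ t)) (FinP.opposite-involutive i))

-- Displacements

displaced : ∀ n m → Fin n → ℕ → ℕ
displaced n m i h = count n m (λ σ → 𝟙 (toℕ i + h ≤? toℕ (lookup σ i)))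

-- By `lookup-≤` a value at least i + h forces a code entry of at least h at i, which
-- `codeCount-tail` bounds.
displaced-bound : ∀ n m (i : Fin n) h →
  ∃[ B ] (h * B * displaced n m i h ≤ 2 * m * count n m (λ _ → 1) × n ≤ suc (B + 2 * h))
displaced-bound n m i h = go (toℕ i) (toℕ (opp i)) refl (opp-sum′ i)
  where
  go : ∀ p q → toℕ i ≡ p → p + suc q ≡ n →
    ∃[ B ] (h * B * displaced n m i h ≤ 2 * m * count n m (λ _ → 1) × n ≤ suc (B + 2 * h))
  go p q ep refl = big h (others p q) , ≤-trans (*-monoʳ-≤ (h * big h (others p q))
      (≤-trans (≤-reflexive (count-decode n m _)) (codeCount-mono n m (λ c →
        𝟙-mono (toℕ i + h ≤? toℕ (lookup (decode c) i)) (h ≤? coord c p) (λ d →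
          subst (λ t → h ≤ coord c t) ep (+-cancelˡ-≤ (toℕ i) h _
            (≤-trans d (≤-trans (lookup-≤ c i) (≤-reflexive (+-comm _ (toℕ i)))))))))))
    (codeCount-tail p q m h) , big-others h p q

-- If the value at i is below i + h, a descent puts the value at j below i + h ≤ j - h. After
-- reverse-complement this is an upward displacement by at least h at `opp j`.
descents-displaced : ∀ n m (i j : Fin n) h → toℕ i + 2 * h ≤ toℕ j →
  descents n m i j ≤ displaced n m i h + displaced n m (opp j) h
descents-displaced n m i j h le = begin
  descents n m i j ≤⟨ count-mono n m split ⟩
  count n m (λ σ → 𝟙 (toℕ i + h ≤? toℕ (lookup σ i)) + 𝟙 (toℕ (opp j) + h ≤? toℕ (lookup (rc σ) (opp j))))
    ≡⟨ count-+ n m _ _ ⟩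
  displaced n m i h + count n m (λ σ → 𝟙 (toℕ (opp j) + h ≤? toℕ (lookup (rc σ) (opp j))))
    ≡⟨ cong (displaced n m i h +_) (count-rc n m (λ σ → 𝟙 (toℕ (opp j) + h ≤? toℕ (lookup σ (opp j))))) ⟩
  displaced n m i h + displaced n m (opp j) h ∎
  where
  open ≤-Reasoning
  low : ∀ σ → lookup σ j Fin.< lookup σ i → ¬ (toℕ i + h ≤ toℕ (lookup σ i)) →
    toℕ (opp j) + h ≤ toℕ (lookup (rc σ) (opp j))
  low σ d ¬p = subst (λ t → toℕ (opp j) + h ≤ toℕ t)
    (sym (trans (lookup-rc σ (opp j)) (cong (λ t → opp (lookup σ t)) (FinP.opposite-involutive j))))
    (linear 2 (+-mono-≤ (+-mono-≤ (≤-reflexive (trans (opp-sum j) (sym (opp-sum (lookup σ j))))) le)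
      (+-mono-≤ d (≰⇒> ¬p)))
      (arith (toℕ (opp j)) h (toℕ j) (toℕ i) (toℕ (opp (lookup σ j))) (toℕ (lookup σ j)) (toℕ (lookup σ i))))
    where
    arith : ∀ oj h j i os s t → oj + h + (os + suc s + j + (t + (i + h))) + 2
      ≡ os + (oj + suc j + (i + 2 * h) + (suc s + suc t))
    arith = solve-∀
  split : ∀ σ → 𝟙 (lookup σ j Fin.<? lookup σ i) ≤
    𝟙 (toℕ i + h ≤? toℕ (lookup σ i)) + 𝟙 (toℕ (opp j) + h ≤? toℕ (lookup (rc σ) (opp j)))
  split σ with toℕ i + h ≤? toℕ (lookup σ i)
  ... | yes _ = ≤-trans (𝟙≤1 (lookup σ j Fin.<? lookup σ i)) (s≤s z≤n)
  ... | no ¬p = 𝟙-mono (lookup σ j Fin.<? lookup σ i) _ (λ d → low σ d ¬p)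

-- Quantitative bounds

-- The maximal number n(n - 1)/2 of inversions, defined along the recursion of `sizes`.
cap : ℕ → ℕ
cap zero    = 0
cap (suc n) = n + cap n

2*cap : ∀ n → 2 * cap n + n ≡ n * n
2*cap zero    = refl
2*cap (suc n) = trans (arith₁ n (cap n)) (trans (cong (λ t → t + 2 * n + 1) (2*cap n)) (arith₂ n))
  where
  arith₁ : ∀ n c → 2 * (n + c) + suc n ≡ 2 * c + n + 2 * n + 1
  arith₁ = solve-∀
  arith₂ : ∀ n → n * n + 2 * n + 1 ≡ suc n * suc n
  arith₂ = solve-∀

Σ-term : ∀ {a b} → a < b → (f : ℕ → ℕ) → f a ≤ Σ< b f
Σ-term {zero}  {suc b} _         f = m≤m+n (f 0) _
Σ-term {suc a} {suc b} (s≤s a<b) f = ≤-trans (Σ-term a<b (f ∘ suc)) (m≤n+m _ (f 0))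

-- Greedy filling: the first entry takes all of m if it can, and otherwise its maximum n.
G-positive : ∀ n m (φ : ℕ → ℕ) → m ≤ cap n → 0 < φ m → 0 < G (sizes n) φ
G-positive zero    zero φ _  pos = pos
G-positive (suc n) m    φ le pos with m ≤? n
... | yes m≤n = ≤-trans
  (G-positive n 0 (λ s → φ (m + s)) z≤n (subst (λ t → 0 < φ t) (sym (+-identityʳ m)) pos))
  (Σ-term (s≤s m≤n) (λ a → G (sizes n) (λ s → φ (a + s))))
... | no m≰n with d , refl ← m≤n⇒∃[o]m+o≡n (≰⇒≥ m≰n) = ≤-trans
  (G-positive n d (λ s → φ (n + s)) (+-cancelˡ-≤ n d (cap n) le) pos)
  (Σ-term ≤-refl (λ a → G (sizes n) (λ s → φ (a + s))))

-- The hypothesis says m ≤ n(n - 1)/2. With no permutation to count, `prob` would be its default 0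
-- and could not be near ½.
count-positive : ∀ n m → 2 * m + n ≤ n * n → 0 < count n m (λ _ → 1)
count-positive n m le = subst (0 <_) (sym (trans (count-decode n m (λ _ → 1))
    (trans (ΣC-tot n (λ s → δ m s * 1)) (G-cong (sizes n) (λ s → *-identityʳ (δ m s))))))
  (G-positive n m (δ m) (*-cancelˡ-≤ 2 (+-cancelʳ-≤ n _ _ (≤-trans le (≤-reflexive (sym (2*cap n))))))
    (≤-reflexive (sym (𝟙-yes (m ≟ m) refl))))

-- Here H ≈ n / 8 and r ≈ m / 4n.
descents-half-bound : ∀ n m (i j : Fin n) l q → toℕ i + suc l ≡ toℕ j → toℕ j + suc q ≡ n → toℕ i ≤ q →
  ∀ e → 1 ≤ e → 14 ≤ n → 4 * n ≤ m → m * (256 * e) ≤ n * n → suc l * (32 * e * n) ≤ m →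
  let T = count n m (λ _ → 1); D = descents n m i j in
  e * (2 * D) ≤ e * T + T × e * T ≤ e * (2 * D) + T
descents-half-bound n m i j l q gap end i≤q e 1≤e 14≤n 4n≤m me≤n² ke≤m = result
  where
  open ≤-Reasoning
  instance
    n≢0 : NonZero n
    n≢0 = >-nonZero (≤-trans (s≤s z≤n) 14≤n)
    4n≢0 : NonZero (4 * n)
    4n≢0 = m*n≢0 4 n
    m≢0 : NonZero m
    m≢0 = >-nonZero (≤-trans (>-nonZero⁻¹ (4 * n)) 4n≤m)
    e≢0 : NonZero e
    e≢0 = >-nonZero 1≤e
    32*e≢0 : NonZero (32 * e)
    32*e≢0 = m*n≢0 32 e
  k = suc l
  T = count n m (λ _ → 1)
  D = descents n m i j
  H = n / 8
  r = m / (4 * n)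
  8H≤n : H * 8 ≤ n
  8H≤n = ≤-trans (m≤n+m (H * 8) (n % 8)) (≤-reflexive (sym (m≡m%n+[m/n]*n n 8)))
  n<8H+8 : n < 8 + H * 8
  n<8H+8 = ≤-trans (s≤s (≤-reflexive (m≡m%n+[m/n]*n n 8))) (+-monoˡ-≤ (H * 8) (m%n<n n 8))
  4rn≤m : r * (4 * n) ≤ m
  4rn≤m = ≤-trans (m≤n+m (r * (4 * n)) (m % (4 * n))) (≤-reflexive (sym (m≡m%n+[m/n]*n m (4 * n))))
  m<4n[r+1] : m < 4 * n + r * (4 * n)
  m<4n[r+1] = ≤-trans (s≤s (≤-reflexive (m≡m%n+[m/n]*n m (4 * n)))) (+-monoˡ-≤ (r * (4 * n)) (m%n<n m (4 * n)))
  1≤r : 1 ≤ r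
  1≤r = positive r m<4n[r+1]
    where
    positive : ∀ r → m < 4 * n + r * (4 * n) → 1 ≤ r
    positive zero    lt = ⊥-elim (<⇒≱ lt (≤-trans (≤-reflexive (+-identityʳ (4 * n))) 4n≤m))
    positive (suc _) _  = s≤s z≤n
  256m≤n² : m * 256 ≤ n * n
  256m≤n² = ≤-trans (*-monoʳ-≤ m (m≤m*n 256 e)) me≤n²
  1024r≤n : 1024 * r ≤ n
  1024r≤n = *-cancelʳ-≤ (1024 * r) n n (begin
    1024 * r * n        ≡⟨ arith r n ⟩
    r * (4 * n) * 256   ≤⟨ *-monoˡ-≤ 256 4rn≤m ⟩
    m * 256             ≤⟨ 256m≤n² ⟩
    n * n ∎)
    where
    arith : ∀ r n → 1024 * r * n ≡ r * (4 * n) * 256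
    arith = solve-∀
  256k≤n : 256 * k ≤ n
  256k≤n = *-cancelʳ-≤ (256 * k) n n (begin
    256 * k * n              ≤⟨ m≤m*n (256 * k * n) (32 * e) ⟩
    256 * k * n * (32 * e)   ≡⟨ arith k n e ⟩
    k * (32 * e * n) * 256   ≤⟨ *-monoˡ-≤ 256 ke≤m ⟩
    m * 256                  ≤⟨ 256m≤n² ⟩
    n * n ∎)
    where
    arith : ∀ k n e → 256 * k * n * (32 * e) ≡ k * (32 * e * n) * 256
    arith = solve-∀
  -- The three terms are at most n/4, 3n/256 and n/512.
  small : 2 * H + 3 * k + 2 * r ≤ n
  small = *-cancelˡ-≤ 1024 (linear (754 * n)
    (+-mono-≤ (+-mono-≤ (*-monoʳ-≤ 256 8H≤n) (*-monoʳ-≤ 12 256k≤n)) (*-monoʳ-≤ 2 1024r≤n))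
    (arith H k r n))
    where
    arith : ∀ H k r n → 1024 * (2 * H + 3 * k + 2 * r) + (256 * n + 12 * n + 2 * n) + 754 * n
      ≡ 1024 * n + (256 * (H * 8) + 12 * (256 * k) + 2 * (1024 * r))
    arith = solve-∀
  -- Since i ≤ q, twice `suc q` exceeds n - k; this is why `small` carries 3k instead of 2k.
  inY : H + k + r ≤ suc q
  inY = *-cancelˡ-≤ 2 (linear 1
    (+-mono-≤ (+-mono-≤ small (≤-reflexive (sym (trans (cong (_+ suc q) gap) end)))) i≤q)
    (arith H k r n (toℕ i) q))
    where
    arith : ∀ H k r n i q → 2 * (H + k + r) + (n + (i + k + suc q) + q) + 1
      ≡ 2 * suc q + (2 * H + 3 * k + 2 * r + n + i)
    arith = solve-∀
  -- M = 2rn serves `V-halving` for up to n other entries. As 4rn ≤ m, a further 2rn is available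
  -- for the remaining terms, which `small` bounds by n ≤ rn.
  fits : H + H + k + r + 2 * r * n ≤ m
  fits = linear (2 * k + r + r * n) (+-mono-≤ (+-mono-≤ small n≤rn) 4rn≤m) (arith H k r n m)
    where
    n≤rn : n ≤ r * n
    n≤rn = ≤-trans (≤-reflexive (sym (*-identityˡ n))) (*-monoˡ-≤ n 1≤r)
    arith : ∀ H k r n m → H + H + k + r + 2 * r * n + (n + r * n + m) + (2 * k + r + r * n)
      ≡ m + (2 * H + 3 * k + 2 * r + n + r * (4 * n))
    arith = solve-∀
  -- From n ≤ 8H + 7, doubled; this is where 14 ≤ n comes from.
  n≤16H : n ≤ 16 * H
  n≤16H = linear 0 (+-mono-≤ (+-mono-≤ n<8H+8 n<8H+8) 14≤n) (arith n H)
    where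
    arith : ∀ n H → n + (8 + H * 8 + (8 + H * 8) + n) + 0 ≡ 16 * H + (suc n + suc n + 14)
    arith = solve-∀
  -- The factor 32 in the hypothesis on the gap is 8 times the 4 in r = m / 4n.
  gap-small : 8 * e * k ≤ suc r
  gap-small = *-cancelˡ-≤ (4 * n) (begin
    4 * n * (8 * e * k)   ≡⟨ arith₁ n e k ⟩
    k * (32 * e * n)      ≤⟨ ke≤m ⟩
    m                     ≤⟨ <⇒≤ m<4n[r+1] ⟩
    4 * n + r * (4 * n)   ≡⟨ arith₂ n r ⟩
    4 * n * suc r ∎)
    where
    arith₁ : ∀ n e k → 4 * n * (8 * e * k) ≡ k * (32 * e * n)
    arith₁ = solve-∀
    arith₂ : ∀ n r → 4 * n + r * (4 * n) ≡ 4 * n * suc r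
    arith₂ = solve-∀
  -- The factor 256: n² is at most 16H times 2B, so 256 e m tl ≤ 32 H B tl ≤ 64 m T.
  tail-small : ∀ B tl → H * B * tl ≤ 2 * m * T → n ≤ suc (B + 2 * H) → 4 * e * tl ≤ T
  tail-small B tl le n≤ = *-cancelˡ-≤ 64 (*-cancelˡ-≤ m (begin
    m * (64 * (4 * e * tl))       ≡⟨ arith₁ m e tl ⟩
    m * (256 * e) * tl            ≤⟨ *-monoˡ-≤ tl me≤n² ⟩
    n * n * tl                    ≤⟨ *-monoˡ-≤ tl (*-mono-≤ n≤16H n≤2B) ⟩
    16 * H * (2 * B) * tl         ≡⟨ arith₂ H B tl ⟩
    32 * (H * B * tl)             ≤⟨ *-monoʳ-≤ 32 le ⟩
    32 * (2 * m * T)              ≡⟨ arith₃ m T ⟩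
    m * (64 * T) ∎))
    where
    n≤2B : n ≤ 2 * B
    n≤2B = *-cancelˡ-≤ 2 (linear 10 (+-mono-≤ (+-mono-≤ (*-monoʳ-≤ 4 n≤) 8H≤n) 14≤n) (arith n B H))
      where
      arith : ∀ n B H → 2 * n + (4 * suc (B + 2 * H) + n + n) + 10 ≡ 2 * (2 * B) + (4 * n + H * 8 + 14)
      arith = solve-∀
    arith₁ : ∀ m e t → m * (64 * (4 * e * t)) ≡ m * (256 * e) * t
    arith₁ = solve-∀
    arith₂ : ∀ H B t → 16 * H * (2 * B) * t ≡ 32 * (H * B * t)
    arith₂ = solve-∀
    arith₃ : ∀ m t → 32 * (2 * m * t) ≡ m * (64 * t)
    arith₃ = solve-∀
  near-small : ∀ tl nr → suc r * nr ≤ 4 * k * T + suc r * tl → 2 * e * nr ≤ T + 2 * e * tl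
  near-small tl nr le = *-cancelˡ-≤ (suc r) (begin
    suc r * (2 * e * nr)                     ≡⟨ arith₁ (suc r) e nr ⟩
    2 * e * (suc r * nr)                     ≤⟨ *-monoʳ-≤ (2 * e) le ⟩
    2 * e * (4 * k * T + suc r * tl)         ≡⟨ arith₂ e k T (suc r) tl ⟩
    8 * e * k * T + suc r * (2 * e * tl)     ≤⟨ +-monoˡ-≤ _ (*-monoˡ-≤ T gap-small) ⟩
    suc r * T + suc r * (2 * e * tl)         ≡⟨ *-distribˡ-+ (suc r) T _ ⟨
    suc r * (T + 2 * e * tl) ∎)
    where
    arith₁ : ∀ s e t → s * (2 * e * t) ≡ 2 * e * (s * t)
    arith₁ = solve-∀
    arith₂ : ∀ e k T s t → 2 * e * (4 * k * T + s * t) ≡ 8 * e * k * T + s * (2 * e * t)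
    arith₂ = solve-∀
  result : e * (2 * D) ≤ e * T + T × e * T ≤ e * (2 * D) + T
  result = combine (descents-half n m i j l q gap end H r (2 * r * n) inY fits ≤-refl
      (≤-trans 1≤r (≤-trans (m≤m+n r (1 * r)) (m≤m*n (2 * r) n))))
    where
    combine : ∃[ tl ] ∃[ nr ] ∃[ B ] (2 * D ≤ T + tl × T ≤ 2 * D + (nr + tl) ×
      suc r * nr ≤ 4 * k * T + suc r * tl × H * B * tl ≤ 2 * m * T × n ≤ suc (B + 2 * H)) →
      e * (2 * D) ≤ e * T + T × e * T ≤ e * (2 * D) + T
    combine (tl , nr , B , up , lo , nr≤ , tl≤ , B≥) =
      (begin
        e * (2 * D)      ≤⟨ *-monoʳ-≤ e up ⟩
        e * (T + tl)     ≡⟨ *-distribˡ-+ e T tl ⟩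
        e * T + e * tl   ≤⟨ +-monoʳ-≤ (e * T) (≤-trans (*-monoˡ-≤ tl (m≤m+n e (3 * e))) tail≤) ⟩
        e * T + T ∎) ,
      (begin
        e * T                              ≤⟨ *-monoʳ-≤ e lo ⟩
        e * (2 * D + (nr + tl))            ≡⟨ *-distribˡ-+ e (2 * D) _ ⟩
        e * (2 * D) + e * (nr + tl)
          -- Four times the error is at most 4T: `near-small` gives 4e nr ≤ 2T + 4e tl, and 4e tl ≤
          -- T is used twice.
          ≤⟨ +-monoʳ-≤ (e * (2 * D)) (*-cancelˡ-≤ 4 (linear 0
               (+-mono-≤ (+-mono-≤ (*-monoʳ-≤ 2 (near-small tl nr nr≤)) tail≤) tail≤) (arith e nr tl T))) ⟩
        e * (2 * D) + T ∎)
      where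
      tail≤ = tail-small B tl tl≤ B≥
      arith : ∀ e nr tl T → 4 * (e * (nr + tl)) + (2 * (T + 2 * e * tl) + T + T) + 0
        ≡ 4 * T + (2 * (2 * e * nr) + 4 * e * tl + 4 * e * tl)
      arith = solve-∀

-- If fewer positions follow j than precede i, the reflected pair, at the same distance, satisfies
-- the condition i ≤ q that keeps the range at j of order n.
descents-half-bound-sym : ∀ n m (i j : Fin n) l → toℕ i + suc l ≡ toℕ j →
  ∀ e → 1 ≤ e → 14 ≤ n → 4 * n ≤ m → m * (256 * e) ≤ n * n → suc l * (32 * e * n) ≤ m →
  let T = count n m (λ _ → 1); D = descents n m i j in
  e * (2 * D) ≤ e * T + T × e * T ≤ e * (2 * D) + T
descents-half-bound-sym n m i j l gap e 1≤e 14≤n h₁ h₂ h₃ with ≤-total (toℕ i) (toℕ (opp j))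
... | inj₁ i≤ = descents-half-bound n m i j l (toℕ (opp j)) gap (opp-sum′ j) i≤ e 1≤e 14≤n h₁ h₂ h₃
... | inj₂ i≥ = subst (λ D → e * (2 * D) ≤ e * T + T × e * T ≤ e * (2 * D) + T) (sym (descents-rc n m i j))
  (descents-half-bound n m (opp j) (opp i) l (toℕ i) gap′ (opp-sum i) i≥ e 1≤e 14≤n h₁ h₂ h₃)
  where
  T = count n m (λ _ → 1)
  gap′ : toℕ (opp j) + suc l ≡ toℕ (opp i)
  gap′ = +-cancelʳ-≡ (suc (toℕ i)) _ _ (trans (arith (toℕ (opp j)) l (toℕ i))
    (trans (cong (λ t → toℕ (opp j) + suc t) gap) (trans (opp-sum j) (sym (opp-sum i)))))
    where
    arith : ∀ o l i → o + suc l + suc i ≡ o + suc (i + suc l)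
    arith = solve-∀

-- With h = k / 4 a descent needs one of two displacements by h. Each is bounded via kn ≤ 8h times
-- 4B, so 128 e times its count is at most 64 T.
descents-vanish : ∀ n m (i j : Fin n) k → toℕ i + k ≡ toℕ j →
  ∀ e → 1 ≤ e → 4 ≤ n → n ≤ m → 128 * e * m ≤ k * n →
  e * descents n m i j ≤ count n m (λ _ → 1)
descents-vanish n m i j k gap e 1≤e 4≤n n≤m em≤kn =
  *-cancelˡ-≤ 128 (begin
    128 * (e * D)                                  ≤⟨ *-monoʳ-≤ 128 (*-monoʳ-≤ e
                                                        (descents-displaced n m i j h 2h-gap)) ⟩
    128 * (e * (W i + W (opp j)))                  ≡⟨ arith e (W i) (W (opp j)) ⟩
    128 * e * W i + 128 * e * W (opp j)            ≤⟨ +-mono-≤ (bound i) (bound (opp j)) ⟩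
    64 * T + 64 * T                                ≡⟨ *-distribʳ-+ T 64 64 ⟨
    128 * T ∎)
  where
  open ≤-Reasoning
  T = count n m (λ _ → 1)
  D = descents n m i j
  h = k / 4
  W : Fin n → ℕ
  W i = displaced n m i h
  arith : ∀ e a b → 128 * (e * (a + b)) ≡ 128 * e * a + 128 * e * b
  arith = solve-∀
  instance
    n≢0 : NonZero n
    n≢0 = >-nonZero (≤-trans (s≤s z≤n) 4≤n)
    m≢0 : NonZero m
    m≢0 = >-nonZero (≤-trans (>-nonZero⁻¹ n) n≤m)
    e≢0 : NonZero e
    e≢0 = >-nonZero 1≤e
  4h≤k : h * 4 ≤ k
  4h≤k = ≤-trans (m≤n+m (h * 4) (k % 4)) (≤-reflexive (sym (m≡m%n+[m/n]*n k 4)))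
  k<4h+4 : k < 4 + h * 4
  k<4h+4 = ≤-trans (s≤s (≤-reflexive (m≡m%n+[m/n]*n k 4))) (+-monoˡ-≤ (h * 4) (m%n<n k 4))
  k≤n : k ≤ n
  k≤n = ≤-trans (m≤n+m k (toℕ i)) (≤-trans (≤-reflexive gap) (<⇒≤ (FinP.toℕ<n j)))
  -- Since n ≤ m, the last hypothesis bounds k from below; the rounding in k / 4 then costs at most
  -- a factor 2.
  128≤k : 128 ≤ k
  128≤k = *-cancelʳ-≤ 128 k n (≤-trans (*-mono-≤ (m≤m*n 128 e) n≤m) em≤kn)
  k≤8h : k ≤ 8 * h
  k≤8h = linear 122 (+-mono-≤ (+-mono-≤ k<4h+4 k<4h+4) 128≤k) (lin k h)
    where
    lin : ∀ k h → k + (4 + h * 4 + (4 + h * 4) + k) + 122 ≡ 8 * h + (suc k + suc k + 128)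
    lin = solve-∀
  2h-gap : toℕ i + 2 * h ≤ toℕ j
  2h-gap = ≤-trans (+-monoʳ-≤ (toℕ i) (linear (2 * h) 4h≤k (lin h k))) (≤-reflexive gap)
    where
    lin : ∀ h k → 2 * h + k + 2 * h ≡ k + h * 4
    lin = solve-∀
  bound : ∀ i → 128 * e * W i ≤ 64 * T
  bound i = use (displaced-bound n m i h)
    where
    use : ∃[ B ] (h * B * W i ≤ 2 * m * T × n ≤ suc (B + 2 * h)) → 128 * e * W i ≤ 64 * T
    use (B , le , n≤) = *-cancelˡ-≤ m (begin
      m * (128 * e * W i)           ≡⟨ arith₁ m (128 * e) (W i) ⟩
      128 * e * m * W i             ≤⟨ *-monoˡ-≤ (W i) em≤kn ⟩
      k * n * W i                   ≤⟨ *-monoˡ-≤ (W i) (*-mono-≤ k≤8h n≤4B) ⟩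
      8 * h * (4 * B) * W i         ≡⟨ arith₂ h B (W i) ⟩
      32 * (h * B * W i)            ≤⟨ *-monoʳ-≤ 32 le ⟩
      32 * (2 * m * T)              ≡⟨ arith₃ m T ⟩
      m * (64 * T) ∎)
      where
      n≤4B : n ≤ 4 * B
      n≤4B = linear 0 (+-mono-≤ (+-mono-≤ (+-mono-≤ (*-monoʳ-≤ 4 n≤) (*-monoʳ-≤ 2 4h≤k)) (*-monoʳ-≤ 2 k≤n)) 4≤n)
        (lin n B h k)
        where
        lin : ∀ n B h k → n + (4 * suc (B + 2 * h) + 2 * k + 2 * n + n) + 0
          ≡ 4 * B + (4 * n + 2 * (h * 4) + 2 * k + 4)
        lin = solve-∀
      arith₁ : ∀ m c t → m * (c * t) ≡ c * m * t
      arith₁ = solve-∀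
      arith₂ : ∀ h B t → 8 * h * (4 * B) * t ≡ 32 * (h * B * t)
      arith₂ = solve-∀
      arith₃ : ∀ m t → 32 * (2 * m * t) ≡ m * (64 * t)
      arith₃ = solve-∀

-- Rational inequalities as inequalities between naturals

frac : ℕ → ℕ → ℚᵘ
frac a b = mkℚᵘ (ℤ.+ a) b

frac-≤ : ∀ a b c d → a * suc d ≤ c * suc b → frac a b ℚᵘ.≤ frac c d
frac-≤ a b c d p = *≤* (subst₂ ℤ._≤_ (ℤP.pos-* a (suc d)) (ℤP.pos-* c (suc b)) (ℤ.+≤+ p))

frac-≤⁻ : ∀ a b c d → frac a b ℚᵘ.≤ frac c d → a * suc d ≤ c * suc b
frac-≤⁻ a b c d (*≤* p) = ℤP.drop‿+≤+ (subst₂ ℤ._≤_ (sym (ℤP.pos-* a (suc d))) (sym (ℤP.pos-* c (suc b))) p)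

frac-* : ∀ a b c d → frac a b ℚᵘ.* frac c d ≡ frac (a * c) (d + b * suc d)
frac-* a b c d = cong (λ z → mkℚᵘ z (d + b * suc d)) (sym (ℤP.pos-* a c))

frac-+ : ∀ a b c d → frac a b ℚᵘ.+ frac c d ≡ frac (a * suc d + c * suc b) (d + b * suc d)
frac-+ a b c d = cong (λ z → mkℚᵘ z (d + b * suc d))
  (cong₂ ℤ._+_ (sym (ℤP.pos-* a (suc d))) (sym (ℤP.pos-* c (suc b))))

toℚᵘ-÷ : ∀ a b → ℚ.toℚᵘ (a ÷ℕ suc b) ℚᵘ.≃ frac a b
toℚᵘ-÷ a b = ℚP.toℚᵘ-fromℚᵘ (frac a b)

÷-nonNeg : ∀ a b → 0ℚ ℚ.≤ a ÷ℕ b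
÷-nonNeg a zero    = ℚP.≤-refl
÷-nonNeg a (suc b) = ℚP.toℚᵘ-cancel-≤ (ℚᵘP.≤-respʳ-≃ (ℚᵘP.≃-sym (toℚᵘ-÷ a b)) (frac-≤ 0 0 a b z≤n))

unit-positive : ∀ c → 1 ≤ c → 0ℚ ℚ.< 1 ÷ℕ c
unit-positive (suc c) _ = ℚP.toℚᵘ-cancel-< (ℚᵘP.<-respʳ-≃ (ℚᵘP.≃-sym (toℚᵘ-÷ 1 c))
  (*<* (ℤ.+<+ z<s)))

-- The definition of `≪` at ε = 1/c, with denominators cleared.
≪-extract : ∀ a b c d e → 1 ≤ b → 1 ≤ c → 1 ≤ e →
  ∣ a ÷ℕ b ∣ ℚ.≤ (1 ÷ℕ c) ℚ.* ∣ d ÷ℕ e ∣ → a * (c * e) ≤ d * b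
≪-extract a (suc b) (suc c) d (suc e) _ _ _ p = ≤-trans
  (frac-≤⁻ a b (1 * d) (e + c * suc e) (subst (frac a b ℚᵘ.≤_) (frac-* 1 c d e)
    (ℚᵘP.≤-respˡ-≃ (toℚᵘ-÷ a b) (ℚᵘP.≤-respʳ-≃
      (ℚᵘP.≃-trans (ℚP.toℚᵘ-homo-* (1 ÷ℕ suc c) (d ÷ℕ suc e)) (ℚᵘP.*-cong (toℚᵘ-÷ 1 c) (toℚᵘ-÷ d e)))
      (ℚP.toℚᵘ-mono-≤ (subst₂ (λ x y → x ℚ.≤ (1 ÷ℕ suc c) ℚ.* y)
        (ℚP.0≤p⇒∣p∣≡p (÷-nonNeg a (suc b))) (ℚP.0≤p⇒∣p∣≡p (÷-nonNeg d (suc e))) p))))))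
  (≤-reflexive (cong (_* suc b) (*-identityˡ d)))

-- A positive rational in lowest terms is at least the reciprocal of its denominator.
unit-below : ∀ ε → 0ℚ ℚ.< ε → ∃[ c ] (1 ÷ℕ suc c ℚ.≤ ε)
unit-below (mkℚ (ℤ.+ suc a) d _) _ = d , ℚP.toℚᵘ-cancel-≤
  (ℚᵘP.≤-respˡ-≃ (ℚᵘP.≃-sym (toℚᵘ-÷ 1 d)) (frac-≤ 1 d (suc a) d (*-monoˡ-≤ (suc d) {1} {suc a} (s≤s z≤n))))
unit-below (mkℚ (ℤ.+ zero) d _) p with ℚP.drop-*<* p
... | ℤ.+<+ ()
unit-below (mkℚ ℤ.-[1+ a ] d _) p with ℚP.drop-*<* p
... | ()

∣∣≤ : ∀ {p u} → p ℚ.≤ u → ℚ.- p ℚ.≤ u → ∣ p ∣ ℚ.≤ u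
∣∣≤ {p} p≤u -p≤u with ℚP.∣p∣≡p∨∣p∣≡-p p
... | inj₁ e = subst (ℚ._≤ _) (sym e) p≤u
... | inj₂ e = subst (ℚ._≤ _) (sym e) -p≤u

≤+⇒-≤ : ∀ p q u → p ℚ.≤ u ℚ.+ q → p ℚ.- q ℚ.≤ u
≤+⇒-≤ p q u le = subst (p ℚ.- q ℚ.≤_) (trans (ℚP.+-assoc u q (ℚ.- q))
  (trans (cong (u ℚ.+_) (ℚP.+-inverseʳ q)) (ℚP.+-identityʳ u))) (ℚP.+-monoˡ-≤ (ℚ.- q) le)

∣-∣≤ : ∀ p q u → p ℚ.≤ u ℚ.+ q → q ℚ.≤ u ℚ.+ p → ∣ p ℚ.- q ∣ ℚ.≤ u
∣-∣≤ p q u p≤ q≤ = ∣∣≤ (≤+⇒-≤ p q u p≤) (subst (ℚ._≤ u) (sym neg) (≤+⇒-≤ q p u q≤))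
  where
  neg : ℚ.- (p ℚ.- q) ≡ q ℚ.- p
  neg = trans (ℚP.neg-distrib-+ p (ℚ.- q)) (trans (cong (ℚ.- p ℚ.+_) (GroupP.⁻¹-involutive ℚP.+-0-group q)) (ℚP.+-comm (ℚ.- p) q))

toℚᵘ-÷-+ : ∀ c q d b → ℚ.toℚᵘ q ℚᵘ.≃ frac d b →
  ℚ.toℚᵘ (1 ÷ℕ suc c ℚ.+ q) ℚᵘ.≃ frac (1 * suc b + d * suc c) (b + c * suc b)
toℚᵘ-÷-+ c q d b e = ℚᵘP.≃-trans (ℚP.toℚᵘ-homo-+ (1 ÷ℕ suc c) q)
  (ℚᵘP.≃-trans (ℚᵘP.+-cong (toℚᵘ-÷ 1 c) e) (ℚᵘP.≃-reflexive (frac-+ 1 c d b)))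

-- Division by 2 (c + 1) T gives even half the stated error; the surplus is the slack T in both uses
-- of `linear`.
near-half : ∀ c D T → 0 < T → suc c * (2 * D) ≤ suc c * T + T → suc c * T ≤ suc c * (2 * D) + T →
  ∣ D ÷ℕ T ℚ.- ½ ∣ ℚ.≤ 1 ÷ℕ suc c
near-half c D (suc t) _ up lo = ∣-∣≤ (D ÷ℕ suc t) ½ (1 ÷ℕ suc c)
  (ℚP.toℚᵘ-cancel-≤ (ℚᵘP.≤-respˡ-≃ (ℚᵘP.≃-sym (toℚᵘ-÷ D t))
    (ℚᵘP.≤-respʳ-≃ (ℚᵘP.≃-sym (toℚᵘ-÷-+ c ½ 1 1 ℚᵘP.≃-refl))
      (frac-≤ D t (1 * 2 + 1 * suc c) (1 + c * 2) (linear (suc t) up (arith₁ c D (suc t)))))))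
  (ℚP.toℚᵘ-cancel-≤ (ℚᵘP.≤-respʳ-≃ (ℚᵘP.≃-sym (toℚᵘ-÷-+ c (D ÷ℕ suc t) D t (toℚᵘ-÷ D t)))
    (frac-≤ 1 1 (1 * suc t + D * suc c) (t + c * suc t) (linear (suc t) lo (arith₂ c D (suc t))))))
  where
  arith₁ : ∀ c D T → D * (2 + c * 2) + (suc c * T + T) + T ≡ (1 * 2 + 1 * suc c) * T + suc c * (2 * D)
  arith₁ = solve-∀
  arith₂ : ∀ c D T → 1 * (T + c * T) + (suc c * (2 * D) + T) + T ≡ (1 * T + D * suc c) * 2 + suc c * T
  arith₂ = solve-∀

near-zero : ∀ c D T → suc c * D ≤ T → ∣ D ÷ℕ T ℚ.- 0ℚ ∣ ℚ.≤ 1 ÷ℕ suc c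
near-zero c D T le = subst (ℚ._≤ 1 ÷ℕ suc c)
  (sym (trans (cong ∣_∣ (ℚP.+-identityʳ (D ÷ℕ T))) (ℚP.0≤p⇒∣p∣≡p (÷-nonNeg D T)))) (small T le)
  where
  small : ∀ T → suc c * D ≤ T → D ÷ℕ T ℚ.≤ 1 ÷ℕ suc c
  -- For T = 0 the quotient is 0 by convention.
  small zero    _  = ÷-nonNeg 1 (suc c)
  small (suc t) le = ℚP.toℚᵘ-cancel-≤ (ℚᵘP.≤-respˡ-≃ (ℚᵘP.≃-sym (toℚᵘ-÷ D t))
    (ℚᵘP.≤-respʳ-≃ (ℚᵘP.≃-sym (toℚᵘ-÷ 1 c))
      (frac-≤ D t 1 c (≤-trans (≤-reflexive (*-comm D (suc c))) (≤-trans le (≤-reflexive (sym (*-identityˡ (suc t)))))))))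

-- From `prob` to descent counts

at-lookup : ∀ {n} (σ : Vec (Fin n) n) (i : Fin n) p → toℕ i ≡ p → at σ (suc p) ≡ toℕ (lookup σ i)
at-lookup {n} σ i p refl with toℕ i <? n
... | yes i<n = cong (toℕ ∘ lookup σ) (FinP.fromℕ<-toℕ i i<n)
... | no ¬p   = ⊥-elim (¬p (FinP.toℕ<n i))

prob-descents : ∀ n m j k → 1 ≤ j → j + k ≤ n → ∃[ i ] ∃[ i′ ] (toℕ i + k ≡ toℕ i′ ×
  prob n m j k ≡ descents n m i i′ ÷ℕ count n m (λ _ → 1))
prob-descents n m (suc p) k _ p+k<n = i , i′ , gap , cong₂ _÷ℕ_
  (trans (length-filter-permsInv n m (λ σ → at σ (suc p + k) <? at σ (suc p)))
    (sum-map-cong (λ σ → cong (δ m (inv σ) *_) (𝟙-cong (at σ (suc p + k) <? at σ (suc p))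
      (lookup σ i′ Fin.<? lookup σ i)
      (subst₂ _<_ (at-lookup σ i′ (p + k) ei′) (at-lookup σ i p ei))
      (subst₂ _<_ (sym (at-lookup σ i′ (p + k) ei′)) (sym (at-lookup σ i p ei))))) (perms n)))
  (length-permsInv n m)
  where
  p<n : p < n
  p<n = ≤-trans (s≤s (m≤m+n p k)) p+k<n
  i = fromℕ< p<n
  i′ = fromℕ< p+k<n
  ei : toℕ i ≡ p
  ei = FinP.toℕ-fromℕ< p<n
  ei′ : toℕ i′ ≡ p + k
  ei′ = FinP.toℕ-fromℕ< p+k<n
  gap : toℕ i + k ≡ toℕ i′
  gap = trans (cong (_+ k) ei) (sym ei′)

prob-near-half : ∀ n m j k c → 1 ≤ j → 1 ≤ k → j + k ≤ n → 14 ≤ n → 4 * n ≤ m →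
  m * (256 * suc c) ≤ n * n → k * (32 * suc c * n) ≤ m → ∣ prob n m j k ℚ.- ½ ∣ ℚ.≤ 1 ÷ℕ suc c
prob-near-half n m j (suc l) c 1≤j _ j+k≤n 14≤n h₁ h₂ h₃ = use (prob-descents n m j (suc l) 1≤j j+k≤n)
  where
  T = count n m (λ _ → 1)
  positive : 0 < T
  positive = count-positive n m (linear (253 * m + 3 * n) (+-mono-≤ h₁
    (≤-trans (*-monoʳ-≤ m (m≤m*n 256 (suc c))) h₂)) (arith n m (n * n)))
    where
    arith : ∀ n m s → 2 * m + n + (m + s) + (253 * m + 3 * n) ≡ s + (4 * n + m * 256)
    arith = solve-∀
  use : ∃[ i ] ∃[ i′ ] (toℕ i + suc l ≡ toℕ i′ × prob n m j (suc l) ≡ descents n m i i′ ÷ℕ T) →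
    ∣ prob n m j (suc l) ℚ.- ½ ∣ ℚ.≤ 1 ÷ℕ suc c
  use (i , i′ , gap , eq) = subst (λ x → ∣ x ℚ.- ½ ∣ ℚ.≤ 1 ÷ℕ suc c) (sym eq)
    (near-half c (descents n m i i′) T positive (proj₁ bounds) (proj₂ bounds))
    where bounds = descents-half-bound-sym n m i i′ l gap (suc c) (s≤s z≤n) 14≤n h₁ h₂ h₃

prob-near-zero : ∀ n m j k c → 1 ≤ j → j + k ≤ n → 4 ≤ n → n ≤ m → 128 * suc c * m ≤ k * n →
  ∣ prob n m j k ℚ.- 0ℚ ∣ ℚ.≤ 1 ÷ℕ suc c
prob-near-zero n m j k c 1≤j j+k≤n 4≤n h₁ h₂ = use (prob-descents n m j k 1≤j j+k≤n)
  where
  use : ∃[ i ] ∃[ i′ ] (toℕ i + k ≡ toℕ i′ × prob n m j k ≡ descents n m i i′ ÷ℕ count n m (λ _ → 1)) →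
    ∣ prob n m j k ℚ.- 0ℚ ∣ ℚ.≤ 1 ÷ℕ suc c
  use (i , i′ , gap , eq) = subst (λ x → ∣ x ℚ.- 0ℚ ∣ ℚ.≤ 1 ÷ℕ suc c) (sym eq)
    (near-zero c (descents n m i i′) _ (descents-vanish n m i i′ k gap (suc c) (s≤s z≤n) 4≤n h₁ h₂))

-- Passage to the limit

1≤log₂ : ∀ n → 2 ≤ n → 1 ≤ ⌊log₂ n ⌋
1≤log₂ n 2≤n = ≤-trans (≤-reflexive (sym (⌊log₂[2^n]⌋≡n 1))) (⌊log₂⌋-mono-≤ 2≤n)

theorem4 : (m k j : ℕ → ℕ)
    → (∀ n → 1 ≤ m n)
    → (∀ n → 1 ≤ k n)
    → (∃[ N₀ ] (∀ n → N₀ ≤ n → 1 ≤ j n × j n + k n ≤ n))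
    → (λ n → ι n) ≪ (λ n → ι (m n))
    → (λ n → ι (m n)) ≪ (λ n → (n ^ 2) ÷ℕ (⌊log₂ n ⌋ ^ 2))
    → ((λ n → ι (k n)) ≪ (λ n → m n ÷ℕ n) → Tendsto (λ n → prob n (m n) (j n) (k n)) ½)
    × ((λ n → m n ÷ℕ n) ≪ (λ n → ι (k n)) → Tendsto (λ n → prob n (m n) (j n) (k n)) 0ℚ)
theorem4 m k j _ 1≤k (N₀ , hj) n≪m m≪n² = half , vanish
  where
  half : (λ n → ι (k n)) ≪ (λ n → m n ÷ℕ n) → Tendsto (λ n → prob n (m n) (j n) (k n)) ½
  half k≪ ε 0<ε = N₀ + (N₁ + (N₂ + (N₃ + 14))) , λ n N≤n →
    let N₀≤n = ≤-trans (m≤m+n N₀ _) N≤n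
        le₁  = ≤-trans (m≤n+m _ N₀) N≤n
        N₁≤n = ≤-trans (m≤m+n N₁ _) le₁
        le₂  = ≤-trans (m≤n+m _ N₁) le₁
        N₂≤n = ≤-trans (m≤m+n N₂ _) le₂
        le₃  = ≤-trans (m≤n+m _ N₂) le₂
        N₃≤n = ≤-trans (m≤m+n N₃ _) le₃
        14≤n = ≤-trans (m≤n+m 14 N₃) le₃
    in ℚP.≤-trans (prob-near-half n (m n) (j n) (k n) c (proj₁ (hj n N₀≤n)) (1≤k n) (proj₂ (hj n N₀≤n)) 14≤n
      (n-m n (proj₂ nm n N₁≤n)) (m-n² n 14≤n (proj₂ mn n N₂≤n)) (k-m n 14≤n (proj₂ km n N₃≤n))) c≤ε
    where
    c = proj₁ (unit-below ε 0<ε)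
    c≤ε = proj₂ (unit-below ε 0<ε)
    -- These choices of ε turn the three asymptotic hypotheses into the numerical ones of
    -- `prob-near-half`.
    nm = n≪m (1 ÷ℕ 4) (unit-positive 4 (s≤s z≤n))
    mn = m≪n² (1 ÷ℕ (256 * suc c)) (unit-positive (256 * suc c) (s≤s z≤n))
    km = k≪ (1 ÷ℕ (32 * suc c)) (unit-positive (32 * suc c) (s≤s z≤n))
    N₁ = proj₁ nm
    N₂ = proj₁ mn
    N₃ = proj₁ km
    n-m : ∀ n → ∣ ι n ∣ ℚ.≤ (1 ÷ℕ 4) ℚ.* ∣ ι (m n) ∣ → 4 * n ≤ m n
    n-m n p = ≤-trans (≤-reflexive (*-comm 4 n))
      (≤-trans (≪-extract n 1 4 (m n) 1 ≤-refl (s≤s z≤n) ≤-refl p) (≤-reflexive (*-identityʳ (m n))))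
    m-n² : ∀ n → 14 ≤ n → ∣ ι (m n) ∣ ℚ.≤ (1 ÷ℕ (256 * suc c)) ℚ.* ∣ (n ^ 2) ÷ℕ (⌊log₂ n ⌋ ^ 2) ∣ →
      m n * (256 * suc c) ≤ n * n
    m-n² n 14≤n p = ≤-trans (*-monoʳ-≤ (m n) (m≤m*n (256 * suc c) (⌊log₂ n ⌋ ^ 2) {{>-nonZero 1≤L²}}))
      (≤-trans (≪-extract (m n) 1 (256 * suc c) (n ^ 2) (⌊log₂ n ⌋ ^ 2) ≤-refl (s≤s z≤n) 1≤L² p)
        (≤-reflexive (trans (*-identityʳ (n ^ 2)) (cong (n *_) (*-identityʳ n)))))
      where
      -- A positive logarithm keeps the quotient off its default value at denominator 0 and makes it
      -- at most n².
      1≤L² : 1 ≤ ⌊log₂ n ⌋ ^ 2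
      1≤L² = m^n>0 ⌊log₂ n ⌋ {{>-nonZero (1≤log₂ n (≤-trans (s≤s (s≤s z≤n)) 14≤n))}} 2
    k-m : ∀ n → 14 ≤ n → ∣ ι (k n) ∣ ℚ.≤ (1 ÷ℕ (32 * suc c)) ℚ.* ∣ m n ÷ℕ n ∣ → k n * (32 * suc c * n) ≤ m n
    k-m n 14≤n p = ≤-trans (≪-extract (k n) 1 (32 * suc c) (m n) n ≤-refl (s≤s z≤n) (≤-trans (s≤s z≤n) 14≤n) p)
      (≤-reflexive (*-identityʳ (m n)))
  vanish : (λ n → m n ÷ℕ n) ≪ (λ n → ι (k n)) → Tendsto (λ n → prob n (m n) (j n) (k n)) 0ℚ
  vanish ≪k ε 0<ε = N₀ + (N₁ + (N₂ + 4)) , λ n N≤n →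
    let N₀≤n = ≤-trans (m≤m+n N₀ _) N≤n
        le₁  = ≤-trans (m≤n+m _ N₀) N≤n
        N₁≤n = ≤-trans (m≤m+n N₁ _) le₁
        le₂  = ≤-trans (m≤n+m _ N₁) le₁
        N₂≤n = ≤-trans (m≤m+n N₂ _) le₂
        4≤n  = ≤-trans (m≤n+m 4 N₂) le₂
    in ℚP.≤-trans (prob-near-zero n (m n) (j n) (k n) c (proj₁ (hj n N₀≤n)) (proj₂ (hj n N₀≤n)) 4≤n
      (n-m n (proj₂ nm n N₁≤n)) (m-k n 4≤n (proj₂ mk n N₂≤n))) c≤ε
    where
    c = proj₁ (unit-below ε 0<ε)
    c≤ε = proj₂ (unit-below ε 0<ε)
    -- Here ε = 1 and ε = 1/(128 (c + 1)) give the hypotheses of `prob-near-zero`.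
    nm = n≪m (1 ÷ℕ 1) (unit-positive 1 ≤-refl)
    mk = ≪k (1 ÷ℕ (128 * suc c)) (unit-positive (128 * suc c) (s≤s z≤n))
    N₁ = proj₁ nm
    N₂ = proj₁ mk
    n-m : ∀ n → ∣ ι n ∣ ℚ.≤ (1 ÷ℕ 1) ℚ.* ∣ ι (m n) ∣ → n ≤ m n
    n-m n p = ≤-trans (≤-reflexive (sym (*-identityʳ n)))
      (≤-trans (≪-extract n 1 1 (m n) 1 ≤-refl ≤-refl ≤-refl p) (≤-reflexive (*-identityʳ (m n))))
    m-k : ∀ n → 4 ≤ n → ∣ m n ÷ℕ n ∣ ℚ.≤ (1 ÷ℕ (128 * suc c)) ℚ.* ∣ ι (k n) ∣ → 128 * suc c * m n ≤ k n * n
    m-k n 4≤n p = ≤-trans (≤-reflexive (trans (*-comm (128 * suc c) (m n))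
        (cong (m n *_) (sym (*-identityʳ (128 * suc c))))))
      (≪-extract (m n) n (128 * suc c) (k n) 1 (≤-trans (s≤s z≤n) 4≤n) (s≤s z≤n) ≤-refl p)
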